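{- Let $K$ be an infinite field, $k\ge1$, $\vec s=(n_1,\dots,n_k)$ a tuple of positive integers, $n=\min(n_1,\dots,n_k)-1$. On $\operatorname{Gr}(\vec s)$ let $\mathcal S_p\subset C_p\otimes\mathcal O_{\operatorname{Gr}(\vec s)}$ be the pullback of the tautological rank-$K'_p(\vec s)$ subbundle on $\operatorname{Gr}(K'_p(\vec s),C_p)$ along the projection $\operatorname{Gr}(\vec s)\to\operatorname{Gr}(K'_p(\vec s),C_p)$, and let $\mathcal S_{p-1}$ be defined similarly in degree $p-1$. For each pair $(p,i)$ with $1\le p\le n$, $0\le i\le p$ and $K'_p(\vec s)>0$, the face map $d_i:C_p\to C_{p-1}$ induces a morphism of vector bundles $$\varphi_{p,i}:\mathcal S_p\longrightarrow\bigl(C_{p-1}\otimes\mathcal O_{\operatorname{Gr}(\vec s)}\bigr)/\mathcal S_{p-1}.$$ Then the incidence variety $\mathbf{Gr}^{\mathrm{simp}}(\vec s)$ is the scheme-theoretic intersection $$\mathbf{Gr}^{\mathrm{simp}}(\vec s)=\bigcap_{p,i}\{\varphi_{p,i}=0\},$$ i.e. the intersection of the rank-$0$ determinantal loci of the bundle maps $\varphi_{p,i}$. In particular, $\mathbf{Gr}^{\mathrm{simp}}(\vec s)$ is a determinantal subvariety of $\operatorname{Gr}(\vec s)$.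
   Context: Notation: $[p]=\{0,\dots,p\}$. Put $M_a(p)=n_a-1-n+p$ (so $M_a(p)\ge p$) and $I_p=\prod_{a=1}^k[M_a(p)]$ for $p\ge 0$. Let $\delta_i^q:[q-1]\to[q]$ be the increasing injection missing $i$ and $\sigma_i^q:[q+1]\to[q]$ the nondecreasing surjection taking the value $i$ twice. $I_\bullet$ is the functor from the simplicial category to sets with $I_\bullet([p])=I_p$, $I_\bullet(\delta_i^p)=\prod_{a}\delta_i^{M_a(p)}:I_{p-1}\to I_p$ and $I_\bullet(\sigma_i^p)=\prod_a\sigma_i^{M_a(p)}:I_{p+1}\to I_p$. $C_\bullet=K[\boldsymbol\Delta^n]$ is the simplicial $K$-vector space with $C_p$ having as basis the nondecreasing maps $\alpha:[p]\to[n]$, with $d_i(\alpha)=\alpha\circ\delta_i^p$; $S_p=\dim C_p=\binom{n+p+1}{p+1}$. For a function $T:I_n\to K$ let $M_{T,p}$ be the matrix with rows indexed by $m\in I_p$, columns by nondecreasing maps $\alpha:[p]\to[n]$, and entries $T(I_\bullet(\alpha)(m))$. The generic rank $R'_p(\vec s)$ is the rank of this matrix over the function field $K(v_u:u\in I_n)$ when $T$ has independent indeterminate entries $T(u)=v_u$; and $K'_p(\vec s)=S_p-R'_p(\vec s)$. $\operatorname{Gr}(r,V)$ is the Grassmannian of $r$-dimensional subspaces of $V$; $\operatorname{Gr}(\vec s)=\prod_{0\le p\le n,\ K'_p(\vec s)>0}\operatorname{Gr}(K'_p(\vec s),C_p)$. The incidence variety $\mathbf{Gr}^{\mathrm{simp}}(\vec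 s)\subset\operatorname{Gr}(\vec s)$ is the closed incidence locus of tuples $(L_p)_p$ satisfying $d_i(L_p)\subseteq L_{p-1}$ for all such pairs $(p,i)$. If $K'_{p-1}(\vec s)=0$, one takes $L_{p-1}=0$ and $\mathcal S_{p-1}=0$. The morphism $\varphi_{p,i}$ is the composite of $\mathcal S_p\subset C_p\otimes\mathcal O$, $d_i\otimes\operatorname{id}$, and the quotient map $C_{p-1}\otimes\mathcal O\to(C_{p-1}\otimes\mathcal O)/\mathcal S_{p-1}$; $\{\varphi_{p,i}=0\}$ is its zero scheme, cut out locally by all matrix entries ($1\times1$ minors). -}

module Defs where

open import Level using (Level; 0ℓ) renaming (suc to lsuc; _⊔_ to _⊔ˡ_)
open import Algebra.Apartness.Bundles using (HeytingField)
open import Algebra.Bundles using (CommutativeRing; CommutativeMonoid)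
open import Algebra.Module.Bundles using (LeftModule; Module)
open import Algebra.Module.Structures using (IsLeftModule; IsModule)
import Algebra.Module.Construct.TensorUnit as TensorUnit
open import Algebra.Structures using (IsCommutativeRing)
import Algebra.Definitions.RawMonoid as RawMonoidDefs
import Algebra.Properties.CommutativeSemigroup as CSP
import Algebra.Properties.AbelianGroup as AbelianGroupProps
import Algebra.Properties.Group as GroupProps
import Algebra.Properties.Semiring.Exp as Exp
import Algebra.Properties.Semiring.Sum as Sum
import Algebra.Properties.Ring as RingProps
open import Algebra.Morphism.Structures using (module RingMorphisms)
open import Data.Bool.Base using (if_then_else_)
open import Data.Empty using (⊥-elim)
open import Data.Fin.Base as Fin using (Fin; zero; suc; punchIn; pinch; splitAt; join; _↑ˡ_)
import Data.Fin.Properties as Fin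
open import Data.List.Base using (List; []; _∷_; length; lookup; filter; allFin; cartesianProductWith)
import Data.List.Membership.Propositional as List using (_∈_)
open import Data.List.Membership.Propositional.Properties
  using (∈-cartesianProductWith⁺; ∈-allFin; ∈-filter⁺; ∈-filter⁻)
open import Data.List.Relation.Unary.All using ([])
open import Data.List.Relation.Unary.Any using (here)
open import Data.List.Relation.Unary.AllPairs using ([]; _∷_)
open import Data.List.Relation.Unary.Unique.Propositional using (Unique)
import Data.List.Relation.Unary.Unique.Propositional.Properties as Unique
open import Data.Nat.Base as ℕ using (ℕ; zero; suc; _∸_; _⊓_)
import Data.Nat.Properties as ℕ
open import Data.Product.Base using (Σ-syntax; ∃-syntax; _×_; _,_; proj₁; proj₂)
open import Data.Sum.Base as ⊎ using (inj₁; inj₂)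
open import Data.Vec.Base as Vec using (Vec)
import Data.Vec.Properties as Vec
open import Data.Vec.Functional using (Vector; foldr)
open import Function.Base using (id; _∘_)
open import Function.Definitions using (Injective)
open import Relation.Binary.Bundles using (Setoid)
open import Relation.Binary.PropositionalEquality as ≡ using (_≡_; _≗_)
open import Relation.Nullary.Decidable using (Dec; yes; no; does; _→-dec_)
open import Relation.Unary using (Pred; Decidable)
import Relation.Binary.Reasoning.Setoid as SetoidReasoning
import Algebra.Solver.Ring.NaturalCoefficients.Default as Solver

private
  variable
    u : Level

-- Not finite: K has m distinct elements for every m.
Infinite : HeytingField u u u → Set u
Infinite K = ∀ m → Σ[ f ∈ (Fin m → Carrier) ] Injective _≡_ _≈_ f
  where open HeytingField K

Ring₀ : (u : Level) → Set (lsuc u)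
Ring₀ u = CommutativeRing u u

∣_∣ : Ring₀ u → Set u
∣ A ∣ = CommutativeRing.Carrier A

record RingHom {u : Level} (A B : Ring₀ u) : Set u where
  private
    module A = CommutativeRing A
    module B = CommutativeRing B
  open RingMorphisms A.rawRing B.rawRing
  field
    ⟦_⟧ : A.Carrier → B.Carrier
    isRingHomomorphism : IsRingHomomorphism ⟦_⟧
  open IsRingHomomorphism isRingHomomorphism public
    using (⟦⟧-cong; +-homo; *-homo; 0#-homo; 1#-homo; -‿homo)

open RingHom using (⟦_⟧)

module _ {u : Level} {A B : Ring₀ u} where
  private
    module A = CommutativeRing A
    module B = CommutativeRing B
  open RingMorphisms A.rawRing B.rawRing

  module _ (f : ∣ A ∣ → ∣ B ∣)
    (f-cong : ∀ {x y} → x A.≈ y → f x B.≈ f y)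
    (f-+ : ∀ x y → f (x A.+ y) B.≈ (f x B.+ f y))
    (f-* : ∀ x y → f (x A.* y) B.≈ (f x B.* f y))
    (f-1# : f A.1# B.≈ B.1#) where

    abstract
      isHom : IsRingHomomorphism f
      isHom = record
        { isSemiringHomomorphism = record
          { isNearSemiringHomomorphism = record
            { +-isMonoidHomomorphism = record
              { isMagmaHomomorphism = record { isRelHomomorphism = record { cong = f-cong } ; homo = f-+ }
              ; ε-homo = f-0# }
            ; *-homo = f-* }
          ; 1#-homo = f-1# }
        ; -‿homo = λ x → B.uniqueˡ-⁻¹ _ _
            (B.trans (B.sym (f-+ _ _)) (B.trans (f-cong (A.-‿inverseˡ x)) f-0#)) }
        where
        f-0# : f A.0# B.≈ B.0#
        f-0# = RingProps.+-identityʳ-unique B.ring _ _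
          (B.trans (B.sym (f-+ _ _)) (f-cong (A.+-identityʳ A.0#)))

    mkHom : RingHom A B
    mkHom = record { ⟦_⟧ = f ; isRingHomomorphism = isHom }

idHom : {A : Ring₀ u} → RingHom A A
idHom {A = A} = mkHom id id (λ _ _ → refl) (λ _ _ → refl) refl
  where open CommutativeRing A

infixr 9 _∘ʰ_
_∘ʰ_ : {A B C : Ring₀ u} → RingHom B C → RingHom A B → RingHom A C
_∘ʰ_ {C = C} g f = mkHom (⟦ g ⟧ ∘ ⟦ f ⟧) (g.⟦⟧-cong ∘ f.⟦⟧-cong)
  (λ x y → trans (g.⟦⟧-cong (f.+-homo x y)) (g.+-homo _ _))
  (λ x y → trans (g.⟦⟧-cong (f.*-homo x y)) (g.*-homo _ _))
  (trans (g.⟦⟧-cong f.1#-homo) g.1#-homo)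
  where
  module f = RingHom f
  module g = RingHom g
  open CommutativeRing C

module Localization {u : Level} (A : CommutativeRing u u)
  (S : Pred (CommutativeRing.Carrier A) u)
  (1∈S : S (CommutativeRing.1# A))
  (*∈S : ∀ {s t} → S s → S t → S (CommutativeRing._*_ A s t)) where

  open CommutativeRing A
  private open module Sol = Solver commutativeSemiring using (solve; _:*_; _:+_; _:=_)
  open SetoidReasoning setoid

  record Fraction : Set u where
    constructor _/_[_]
    field
      num : Carrier
      den : Carrier
      den∈S : S den
  open Fraction public

  infix 4 _∼_
  record _∼_ (x y : Fraction) : Set u where
    constructor equal
    field
      {by} : Carrier
      by∈S : S by
      eq : by * (num x * den y) ≈ by * (num y * den x)

  ∼-refl : ∀ {x} → x ∼ x
  ∼-refl = equal 1∈S refl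

  ∼-trans : ∀ {x y z} → x ∼ y → y ∼ z → x ∼ z
  ∼-trans {x} {y} {z} (equal {t} t∈ p) (equal {t′} t′∈ q) =
    equal (*∈S (*∈S t∈ t′∈) (den∈S y)) (begin
      (t * t′) * den y * (num x * den z)
        ≈⟨ solve 5 (λ t t′ dy nx dz → ((t :* t′) :* dy) :* (nx :* dz) := (t′ :* dz) :* (t :* (nx :* dy))) refl t t′ (den y) (num x) (den z) ⟩
      (t′ * den z) * (t * (num x * den y))
        ≈⟨ *-congˡ p ⟩
      (t′ * den z) * (t * (num y * den x))
        ≈⟨ solve 5 (λ t t′ ny dx dz → (t′ :* dz) :* (t :* (ny :* dx)) := (t :* dx) :* (t′ :* (ny :* dz))) refl t t′ (num y) (den x) (den z) ⟩
      (t * den x) * (t′ * (num y * den z))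
        ≈⟨ *-congˡ q ⟩
      (t * den x) * (t′ * (num z * den y))
        ≈⟨ solve 5 (λ t t′ dy nz dx → (t :* dx) :* (t′ :* (nz :* dy)) := ((t :* t′) :* dy) :* (nz :* dx)) refl t t′ (den y) (num z) (den x) ⟩
      (t * t′) * den y * (num z * den x) ∎)

  ≈⇒∼ : ∀ {x y} → num x * den y ≈ num y * den x → x ∼ y
  ≈⇒∼ p = equal 1∈S (*-congˡ p)

  _+ᶠ_ _*ᶠ_ : Fraction → Fraction → Fraction
  x +ᶠ y = (num x * den y + num y * den x) / den x * den y [ *∈S (den∈S x) (den∈S y) ]
  x *ᶠ y = (num x * num y) / den x * den y [ *∈S (den∈S x) (den∈S y) ]

  -ᶠ_ : Fraction → Fraction
  -ᶠ x = (- num x) / den x [ den∈S x ]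

  fromRing : Carrier → Fraction
  fromRing a = a / 1# [ 1∈S ]

  private
    +ᶠ-cong : ∀ {x x′ y y′} → x ∼ x′ → y ∼ y′ → (x +ᶠ y) ∼ (x′ +ᶠ y′)
    +ᶠ-cong {a / s [ _ ]} {a′ / s′ [ _ ]} {b / r [ _ ]} {b′ / r′ [ _ ]} (equal {t} t∈ p) (equal {v} v∈ q) =
      equal (*∈S t∈ v∈) (begin
        (t * v) * ((a * r + b * s) * (s′ * r′))
          ≈⟨ solve 8 (λ t v a r b s s′ r′ →
              (t :* v) :* (((a :* r) :+ (b :* s)) :* (s′ :* r′)) :=
              ((v :* (r :* r′)) :* (t :* (a :* s′))) :+ ((t :* (s :* s′)) :* (v :* (b :* r′)))) refl t v a r b s s′ r′ ⟩
        (v * (r * r′)) * (t * (a * s′)) + (t * (s * s′)) * (v * (b * r′))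
          ≈⟨ +-cong (*-congˡ p) (*-congˡ q) ⟩
        (v * (r * r′)) * (t * (a′ * s)) + (t * (s * s′)) * (v * (b′ * r))
          ≈⟨ solve 8 (λ t v a′ r b′ s s′ r′ →
              ((v :* (r :* r′)) :* (t :* (a′ :* s))) :+ ((t :* (s :* s′)) :* (v :* (b′ :* r))) :=
              (t :* v) :* (((a′ :* r′) :+ (b′ :* s′)) :* (s :* r))) refl t v a′ r b′ s s′ r′ ⟩
        (t * v) * ((a′ * r′ + b′ * s′) * (s * r)) ∎)

    *ᶠ-cong : ∀ {x x′ y y′} → x ∼ x′ → y ∼ y′ → (x *ᶠ y) ∼ (x′ *ᶠ y′)
    *ᶠ-cong {a / s [ _ ]} {a′ / s′ [ _ ]} {b / r [ _ ]} {b′ / r′ [ _ ]} (equal {t} t∈ p) (equal {v} v∈ q) =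
      equal (*∈S t∈ v∈) (begin
        (t * v) * ((a * b) * (s′ * r′))
          ≈⟨ solve 6 (λ t v a b s′ r′ →
              (t :* v) :* ((a :* b) :* (s′ :* r′)) :=
              (t :* (a :* s′)) :* (v :* (b :* r′))) refl t v a b s′ r′ ⟩
        (t * (a * s′)) * (v * (b * r′))
          ≈⟨ *-cong p q ⟩
        (t * (a′ * s)) * (v * (b′ * r))
          ≈⟨ solve 6 (λ t v a′ b′ s r →
              (t :* (a′ :* s)) :* (v :* (b′ :* r)) :=
              (t :* v) :* ((a′ :* b′) :* (s :* r))) refl t v a′ b′ s r ⟩
        (t * v) * ((a′ * b′) * (s * r)) ∎)

    -ᶠ-cong : ∀ {x x′} → x ∼ x′ → (-ᶠ x) ∼ (-ᶠ x′)
    -ᶠ-cong {a / s [ _ ]} {a′ / s′ [ _ ]} (equal {t} t∈ p) = equal t∈ (begin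
      t * (- a * s′)   ≈⟨ neg t a s′ ⟩
      - (t * (a * s′)) ≈⟨ -‿cong p ⟩
      - (t * (a′ * s)) ≈⟨ neg t a′ s ⟨
      t * (- a′ * s) ∎)
      where
      neg : ∀ t a s → t * (- a * s) ≈ - (t * (a * s))
      neg t a s = trans (*-congˡ (sym (RingProps.-‿distribˡ-* ring a s))) (sym (RingProps.-‿distribʳ-* ring t (a * s)))

    +ᶠ-assoc : ∀ x y z → ((x +ᶠ y) +ᶠ z) ∼ (x +ᶠ (y +ᶠ z))
    +ᶠ-assoc (a / s [ _ ]) (b / r [ _ ]) (c / q [ _ ]) = ≈⇒∼ (solve 6 (λ a s b r c q →
      ((((a :* r) :+ (b :* s)) :* q) :+ (c :* (s :* r))) :* (s :* (r :* q)) :=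
      ((a :* (r :* q)) :+ (((b :* q) :+ (c :* r)) :* s)) :* ((s :* r) :* q)) refl a s b r c q)

    *ᶠ-assoc : ∀ x y z → ((x *ᶠ y) *ᶠ z) ∼ (x *ᶠ (y *ᶠ z))
    *ᶠ-assoc (a / s [ _ ]) (b / r [ _ ]) (c / q [ _ ]) = ≈⇒∼ (solve 6 (λ a s b r c q →
      ((a :* b) :* c) :* (s :* (r :* q)) :=
      (a :* (b :* c)) :* ((s :* r) :* q)) refl a s b r c q)

    distribˡᶠ : ∀ x y z → (x *ᶠ (y +ᶠ z)) ∼ ((x *ᶠ y) +ᶠ (x *ᶠ z))
    distribˡᶠ (a / s [ _ ]) (b / r [ _ ]) (c / q [ _ ]) = ≈⇒∼ (solve 6 (λ a s b r c q →
      (a :* ((b :* q) :+ (c :* r))) :* ((s :* r) :* (s :* q)) :=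
      (((a :* b) :* (s :* q)) :+ ((a :* c) :* (s :* r))) :* (s :* (r :* q))) refl a s b r c q)

    +ᶠ-comm : ∀ x y → (x +ᶠ y) ∼ (y +ᶠ x)
    +ᶠ-comm (a / s [ _ ]) (b / r [ _ ]) = ≈⇒∼ (*-cong (+-comm _ _) (*-comm _ _))

    *ᶠ-comm : ∀ x y → (x *ᶠ y) ∼ (y *ᶠ x)
    *ᶠ-comm (a / s [ _ ]) (b / r [ _ ]) = ≈⇒∼ (*-cong (*-comm _ _) (*-comm _ _))

    +ᶠ-identityˡ : ∀ x → (fromRing 0# +ᶠ x) ∼ x
    +ᶠ-identityˡ (a / s [ _ ]) = ≈⇒∼ (begin
      (0# * s + a * 1#) * s  ≈⟨ *-congʳ (trans (+-cong (zeroˡ s) (*-identityʳ a)) (+-identityˡ a)) ⟩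
      a * s                  ≈⟨ *-congˡ (*-identityˡ s) ⟨
      a * (1# * s) ∎)

    *ᶠ-identityˡ : ∀ x → (fromRing 1# *ᶠ x) ∼ x
    *ᶠ-identityˡ (a / s [ _ ]) = ≈⇒∼ (begin
      (1# * a) * s  ≈⟨ *-congʳ (*-identityˡ a) ⟩
      a * s         ≈⟨ *-congˡ (*-identityˡ s) ⟨
      a * (1# * s) ∎)

    -ᶠ-inverseˡ : ∀ x → ((-ᶠ x) +ᶠ x) ∼ fromRing 0#
    -ᶠ-inverseˡ (a / s [ _ ]) = ≈⇒∼ (begin
      (- a * s + a * s) * 1#  ≈⟨ *-identityʳ _ ⟩
      - a * s + a * s         ≈⟨ distribʳ s (- a) a ⟨
      (- a + a) * s           ≈⟨ *-congʳ (-‿inverseˡ a) ⟩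
      0# * s                  ≈⟨ zeroˡ s ⟩
      0#                      ≈⟨ zeroˡ _ ⟨
      0# * (s * s) ∎)

  ∼-sym : ∀ {x y} → x ∼ y → y ∼ x
  ∼-sym (equal t∈ p) = equal t∈ (sym p)

  abstract
    localization-isCommutativeRing :
      IsCommutativeRing _∼_ _+ᶠ_ _*ᶠ_ -ᶠ_ (fromRing 0#) (fromRing 1#)
    localization-isCommutativeRing = record
        { isRing = record
          { +-isAbelianGroup = record
            { isGroup = record
              { isMonoid = record
                { isSemigroup = record
                  { isMagma = record
                    { isEquivalence = record { refl = ∼-refl ; sym = ∼-sym ; trans = ∼-trans }
                    ; ∙-cong = +ᶠ-cong }
                  ; assoc = +ᶠ-assoc }
                ; identity = +ᶠ-identityˡ , λ x → ∼-trans (+ᶠ-comm x _) (+ᶠ-identityˡ x) }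
              ; inverse = -ᶠ-inverseˡ , λ x → ∼-trans (+ᶠ-comm x _) (-ᶠ-inverseˡ x)
              ; ⁻¹-cong = -ᶠ-cong }
            ; comm = +ᶠ-comm }
          ; *-cong = *ᶠ-cong
          ; *-assoc = *ᶠ-assoc
          ; *-identity = *ᶠ-identityˡ , λ x → ∼-trans (*ᶠ-comm x _) (*ᶠ-identityˡ x)
          ; distrib = distribˡᶠ , λ x y z → ∼-trans (*ᶠ-comm _ x)
              (∼-trans (distribˡᶠ x y z) (+ᶠ-cong (*ᶠ-comm x y) (*ᶠ-comm x z))) }
        ; *-comm = *ᶠ-comm }

  localization : CommutativeRing u u
  localization = record
    { Carrier = Fraction ; _≈_ = _∼_ ; _+_ = _+ᶠ_ ; _*_ = _*ᶠ_ ; -_ = -ᶠ_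
    ; 0# = fromRing 0# ; 1# = fromRing 1#
    ; isCommutativeRing = localization-isCommutativeRing }

  ι : RingHom A localization
  ι = mkHom fromRing
    (λ p → ≈⇒∼ (*-congʳ p))
    (λ x y → ≈⇒∼ (*-cong (+-cong (sym (*-identityʳ x)) (sym (*-identityʳ y))) (*-identityˡ 1#)))
    (λ x y → ≈⇒∼ (*-congˡ (*-identityˡ 1#)))
    ∼-refl

powersOf : (A : Ring₀ u) → ∣ A ∣ → Pred ∣ A ∣ u
powersOf A f s = ∃[ k ] s ≈ f ^ k
  where
  open CommutativeRing A
  open Exp semiring

module Away {u : Level} (A : CommutativeRing u u) (f : CommutativeRing.Carrier A) where
  open CommutativeRing A
  open Exp semiring

  powers-* : ∀ {s t} → powersOf A f s → powersOf A f t → powersOf A f (s * t)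
  powers-* (k , p) (l , q) = k ℕ.+ l , trans (*-cong p q) (sym (^-homo-* f k l))

  open Localization A (powersOf A f) (0 , refl) powers-* public

infix 9 _[1/_]
-- Opaque only for the speed of type checking.
opaque
  _[1/_] : (A : Ring₀ u) → ∣ A ∣ → Ring₀ u
  A [1/ f ] = Away.localization A f

  localize : (A : Ring₀ u) (f : ∣ A ∣) → RingHom A (A [1/ f ])
  localize A f = Away.ι A f

  localize-surjective : (A : Ring₀ u) (f : ∣ A ∣) (z : ∣ A [1/ f ] ∣) →
    let open CommutativeRing (A [1/ f ])
        open Exp (CommutativeRing.semiring A) using (_^_)
    in ∃[ k ] ∃[ a ] ⟦ localize A f ⟧ (f ^ k) * z ≈ ⟦ localize A f ⟧ a
  localize-surjective A f (a Away./ s [ k , p ]) = k , a , Away.≈⇒∼ A f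
    (trans (*-identityʳ _) (trans (*-comm _ a) (*-congˡ (trans (sym p) (sym (*-identityˡ s))))))
    where open CommutativeRing A

  localize-kernel : (A : Ring₀ u) (f : ∣ A ∣) {a b : ∣ A ∣} →
    CommutativeRing._≈_ (A [1/ f ]) (⟦ localize A f ⟧ a) (⟦ localize A f ⟧ b) →
    let open CommutativeRing A
        open Exp semiring using (_^_)
    in ∃[ k ] f ^ k * a ≈ f ^ k * b
  localize-kernel A f {a} {b} (Away.equal (k , p) eq) = k ,
    trans (*-cong (sym p) (sym (*-identityʳ a))) (trans eq (*-cong p (*-identityʳ b)))
    where open CommutativeRing A

  awayMap : {A B : Ring₀ u} (h : RingHom A B) (f : ∣ A ∣) →
            RingHom (A [1/ f ]) (B [1/ ⟦ h ⟧ f ])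
  awayMap {A = A} {B} h f = mkHom map-fraction
    (λ { (A′.equal t∈ p) → B′.equal (powers t∈)
        (B.trans (B.trans (B.*-congˡ (B.sym (*-homo _ _))) (B.sym (*-homo _ _)))
          (B.trans (⟦⟧-cong p)
            (B.trans (*-homo _ _) (B.*-congˡ (*-homo _ _))))) })
    (λ _ _ → B′.≈⇒∼ (B.*-cong (B.trans (+-homo _ _) (B.+-cong (*-homo _ _) (*-homo _ _)))
                               (B.sym (*-homo _ _))))
    (λ _ _ → B′.≈⇒∼ (B.*-cong (*-homo _ _) (B.sym (*-homo _ _))))
    (B′.≈⇒∼ (B.*-comm _ _))
    where
    module A = CommutativeRing A
    module B = CommutativeRing B
    module A′ = Away A f
    module B′ = Away B (⟦ h ⟧ f)
    open RingHom h using (⟦⟧-cong; +-homo; *-homo; 1#-homo)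

    pow : ∀ k → ⟦ h ⟧ (Exp._^_ A.semiring f k) B.≈ Exp._^_ B.semiring (⟦ h ⟧ f) k
    pow zero    = 1#-homo
    pow (suc k) = B.trans (*-homo _ _) (B.*-congˡ (pow k))

    powers : ∀ {s} → powersOf A f s → powersOf B (⟦ h ⟧ f) (⟦ h ⟧ s)
    powers (k , p) = k , B.trans (⟦⟧-cong p) (pow k)

    map-fraction : A′.Fraction → B′.Fraction
    map-fraction (a A′./ s [ s∈ ]) = ⟦ h ⟧ a B′./ ⟦ h ⟧ s [ powers s∈ ]

  away-square : {A B : Ring₀ u} (h : RingHom A B) (f a : ∣ A ∣) → CommutativeRing._≈_ (B [1/ ⟦ h ⟧ f ])
    (⟦ localize B (⟦ h ⟧ f) ⟧ (⟦ h ⟧ a)) (⟦ awayMap h f ⟧ (⟦ localize A f ⟧ a))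
  away-square {A = A} {B} h f a = Away.≈⇒∼ B (⟦ h ⟧ f) (*-congˡ (RingHom.1#-homo h))
    where open CommutativeRing B

UnitIdeal : (A : Ring₀ u) {m : ℕ} → Vector ∣ A ∣ m → Set u
UnitIdeal A {m} f = Σ[ a ∈ Vector ∣ A ∣ m ] sum (λ j → a j * f j) ≈ 1#
  where
  open CommutativeRing A
  open Sum semiring

Mod : Ring₀ u → Set (lsuc u)
Mod {u} A = Module A u u

-- The proofs of the module laws are abstract, to keep comparisons of modules cheap.
module _ {u : Level} (A : Ring₀ u) (M : LeftModule (CommutativeRing.ring A) u u) where
  open CommutativeRing A
  open LeftModule M

  abstract
    fromLeft-isModule : IsModule A _≈ᴹ_ _+ᴹ_ 0ᴹ -ᴹ_ _*ₗ_ (λ x a → a *ₗ x)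
    fromLeft-isModule = record
      { isBimodule = record
        { isBisemimodule = record
          { +ᴹ-isCommutativeMonoid = +ᴹ-isCommutativeMonoid
          ; isPreleftSemimodule = isPreleftSemimodule
          ; isPrerightSemimodule = record
            { *ᵣ-cong = λ p q → *ₗ-cong q p
            ; *ᵣ-zeroʳ = *ₗ-zeroˡ
            ; *ᵣ-distribˡ = λ x a b → *ₗ-distribʳ x a b
            ; *ᵣ-identityʳ = *ₗ-identityˡ
            ; *ᵣ-assoc = λ x a b → ≈ᴹ-trans (≈ᴹ-sym (*ₗ-assoc b a x)) (*ₗ-congʳ (*-comm b a))
            ; *ᵣ-zeroˡ = *ₗ-zeroʳ
            ; *ᵣ-distribʳ = λ a x y → *ₗ-distribˡ a x y }
          ; *ₗ-*ᵣ-assoc = λ a x b → ≈ᴹ-trans (≈ᴹ-sym (*ₗ-assoc b a x))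
              (≈ᴹ-trans (*ₗ-congʳ (*-comm b a)) (*ₗ-assoc a b x)) }
        ; -ᴹ‿cong = -ᴹ‿cong
        ; -ᴹ‿inverse = -ᴹ‿inverse }
      ; *ₗ-*ᵣ-coincident = λ _ _ → ≈ᴹ-refl }

  fromLeftModule : Mod A
  fromLeftModule = record
    { -ᴹ_ = -ᴹ_ ; _*ₗ_ = _*ₗ_ ; _*ᵣ_ = λ x a → a *ₗ x ; isModule = fromLeft-isModule }

∣_∣ᴹ : {A : Ring₀ u} → Mod A → Set u
∣ M ∣ᴹ = Module.Carrierᴹ M

record SemiLinear {u : Level} {A B : Ring₀ u} (h : RingHom A B) (M : Mod A) (N : Mod B) : Set u where
  private
    module M = Module M
    module N = Module N
  field
    fun     : M.Carrierᴹ → N.Carrierᴹ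
    cong    : ∀ {x y} → x M.≈ᴹ y → fun x N.≈ᴹ fun y
    +ᴹ-homo : ∀ x y → fun (x M.+ᴹ y) N.≈ᴹ (fun x N.+ᴹ fun y)
    *ₗ-homo : ∀ a x → fun (a M.*ₗ x) N.≈ᴹ (⟦ h ⟧ a N.*ₗ fun x)

  0ᴹ-homo : fun M.0ᴹ N.≈ᴹ N.0ᴹ
  0ᴹ-homo = N.≈ᴹ-trans (cong (M.≈ᴹ-sym (M.*ₗ-zeroˡ M.0ᴹ)))
    (N.≈ᴹ-trans (*ₗ-homo _ _)
      (N.≈ᴹ-trans (N.*ₗ-congʳ (RingHom.0#-homo h)) (N.*ₗ-zeroˡ _)))

open SemiLinear using (fun)

Linear : {A : Ring₀ u} → Mod A → Mod A → Set u
Linear = SemiLinear idHom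

module _ {u : Level} {A : Ring₀ u} (M : Mod A) where
  open CommutativeRing A hiding (zero)
  open Module M
  open RawMonoidDefs +ᴹ-rawMonoid using () renaming (sum to sumᴹ)

  lincomb : ∀ {r} → Vector Carrier r → Vector Carrierᴹ r → Carrierᴹ
  lincomb c e = sumᴹ (λ i → c i *ₗ e i)

  record IsBasis {r : ℕ} (e : Vector Carrierᴹ r) : Set u where
    field
      generating  : ∀ x → ∃[ c ] x ≈ᴹ lincomb c e
      independent : ∀ c → lincomb c e ≈ᴹ 0ᴹ → ∀ i → c i ≈ 0#

  Basis : ℕ → Set u
  Basis r = ∃[ e ] IsBasis {r} e

  open SetoidReasoning ≈ᴹ-setoid

  lincomb-cong : ∀ {r} {c d : Vector Carrier r} {e f} →
                 (∀ i → c i ≈ d i) → (∀ i → e i ≈ᴹ f i) → lincomb c e ≈ᴹ lincomb d f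
  lincomb-cong {zero}  p q = ≈ᴹ-refl
  lincomb-cong {suc r} p q = +ᴹ-cong (*ₗ-cong (p zero) (q zero)) (lincomb-cong (p ∘ suc) (q ∘ suc))

  lincomb-zero : ∀ {r} (e : Vector Carrierᴹ r) → lincomb (λ _ → 0#) e ≈ᴹ 0ᴹ
  lincomb-zero {zero}  e = ≈ᴹ-refl
  lincomb-zero {suc r} e = ≈ᴹ-trans (+ᴹ-cong (*ₗ-zeroˡ _) (lincomb-zero (e ∘ suc))) (+ᴹ-identityˡ 0ᴹ)

  lincomb-+ : ∀ {r} (c d : Vector Carrier r) e →
              lincomb (λ i → c i + d i) e ≈ᴹ lincomb c e +ᴹ lincomb d e
  lincomb-+ {zero}  c d e = ≈ᴹ-sym (+ᴹ-identityˡ 0ᴹ)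
  lincomb-+ {suc r} c d e = begin
    (c zero + d zero) *ₗ e zero +ᴹ lincomb (λ i → c (suc i) + d (suc i)) (e ∘ suc)
      ≈⟨ +ᴹ-cong (*ₗ-distribʳ _ _ _) (lincomb-+ (c ∘ suc) (d ∘ suc) (e ∘ suc)) ⟩
    (c zero *ₗ e zero +ᴹ d zero *ₗ e zero) +ᴹ (lincomb (c ∘ suc) (e ∘ suc) +ᴹ lincomb (d ∘ suc) (e ∘ suc))
      ≈⟨ interchange _ _ _ _ ⟩
    lincomb c e +ᴹ lincomb d e ∎
    where open CSP (CommutativeMonoid.commutativeSemigroup +ᴹ-commutativeMonoid) using (interchange)

  lincomb-* : ∀ {r} a (c : Vector Carrier r) e → lincomb (λ i → a * c i) e ≈ᴹ a *ₗ lincomb c e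
  lincomb-* {zero}  a c e = ≈ᴹ-sym (*ₗ-zeroʳ a)
  lincomb-* {suc r} a c e = ≈ᴹ-trans
    (+ᴹ-cong (*ₗ-assoc _ _ _) (lincomb-* a (c ∘ suc) (e ∘ suc)))
    (≈ᴹ-sym (*ₗ-distribˡ _ _ _))

  lincomb-lincomb : ∀ {r s} (d : Vector Carrier s) (c : Fin s → Vector Carrier r) e →
    lincomb d (λ b → lincomb (c b) e) ≈ᴹ
    lincomb (λ i → RawMonoidDefs.sum +-rawMonoid (λ b → d b * c b i)) e
  lincomb-lincomb {s = zero}  d c e = ≈ᴹ-sym (lincomb-zero e)
  lincomb-lincomb {s = suc s} d c e = ≈ᴹ-trans
    (+ᴹ-cong (≈ᴹ-sym (lincomb-* (d zero) (c zero) e)) (lincomb-lincomb (d ∘ suc) (c ∘ suc) e))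
    (≈ᴹ-sym (lincomb-+ _ _ e))

  lincomb-difference : ∀ {r} (c d : Vector Carrier r) e → lincomb c e ≈ᴹ lincomb d e →
                       lincomb (λ i → c i - d i) e ≈ᴹ 0ᴹ
  lincomb-difference c d e p = begin
    lincomb (λ i → c i - d i) e
      ≈⟨ lincomb-+ c (λ i → - d i) e ⟩
    lincomb c e +ᴹ lincomb (λ i → - d i) e
      ≈⟨ +ᴹ-congʳ p ⟩
    lincomb d e +ᴹ lincomb (λ i → - d i) e
      ≈⟨ lincomb-+ d (λ i → - d i) e ⟨
    lincomb (λ i → d i - d i) e
      ≈⟨ lincomb-cong (λ i → -‿inverseʳ (d i)) (λ _ → ≈ᴹ-refl) ⟩
    lincomb (λ _ → 0#) e
      ≈⟨ lincomb-zero e ⟩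
    0ᴹ ∎

  coordinates-unique : ∀ {r} {e : Vector Carrierᴹ r} → IsBasis e → (c d : Vector Carrier r) →
                       lincomb c e ≈ᴹ lincomb d e → ∀ i → c i ≈ d i
  coordinates-unique {e = e} basis c d p i =
    x∙y⁻¹≈ε⇒x≈y (c i) (d i) (IsBasis.independent basis (λ j → c j - d j) (lincomb-difference c d e p) i)
    where open GroupProps +-group using (x∙y⁻¹≈ε⇒x≈y)

unitᴹ : (A : Ring₀ u) → Mod A
unitᴹ A = TensorUnit.⟨module⟩

unitMap : {A B : Ring₀ u} (h : RingHom A B) → SemiLinear h (unitᴹ A) (unitᴹ B)
unitMap h = record { fun = ⟦ h ⟧ ; cong = ⟦⟧-cong ; +ᴹ-homo = +-homo ; *ₗ-homo = *-homo }
  where open RingHom h using (⟦⟧-cong; +-homo; *-homo)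

lincomb-comm : (A : Ring₀ u) → ∀ {r} (c d : Vector ∣ A ∣ r) →
               CommutativeRing._≈_ A (lincomb (unitᴹ A) c d) (lincomb (unitᴹ A) d c)
lincomb-comm A {zero}  c d = CommutativeRing.refl A
lincomb-comm A {suc r} c d = +-cong (*-comm _ _) (lincomb-comm A (c ∘ suc) (d ∘ suc))
  where open CommutativeRing A using (+-cong; *-comm)

fun-lincomb : {A B : Ring₀ u} {h : RingHom A B} {M : Mod A} {N : Mod B} (φ : SemiLinear h M N) →
  ∀ {r} (c : Vector ∣ A ∣ r) e →
  Module._≈ᴹ_ N (fun φ (lincomb M c e)) (lincomb N (⟦ h ⟧ ∘ c) (fun φ ∘ e))
fun-lincomb φ {zero}  c e = SemiLinear.0ᴹ-homo φ
fun-lincomb {N = N} φ {suc r} c e = ≈ᴹ-trans (SemiLinear.+ᴹ-homo φ _ _)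
  (+ᴹ-cong (SemiLinear.*ₗ-homo φ _ _) (fun-lincomb φ (c ∘ suc) (e ∘ suc)))
  where open Module N

δ : (A : Ring₀ u) {N : ℕ} → Fin N → Vector ∣ A ∣ N
δ A i j = if does (i Fin.≟ j) then 1# else 0#
  where open CommutativeRing A

δ-sym : (A : Ring₀ u) → ∀ {N} (i j : Fin N) → CommutativeRing._≈_ A (δ A i j) (δ A j i)
δ-sym A i j with i Fin.≟ j | j Fin.≟ i
... | yes _  | yes _  = CommutativeRing.refl A
... | no  _  | no  _  = CommutativeRing.refl A
... | yes eq | no neq = ⊥-elim (neq (≡.sym eq))
... | no neq | yes eq = ⊥-elim (neq (≡.sym eq))

hom-δ : {A B : Ring₀ u} (h : RingHom A B) → ∀ {N} (i j : Fin N) →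
        CommutativeRing._≈_ B (⟦ h ⟧ (δ A i j)) (δ B i j)
hom-δ h i j with i Fin.≟ j
... | yes _ = RingHom.1#-homo h
... | no  _ = RingHom.0#-homo h

module _ {u : Level} {A : Ring₀ u} (M : Mod A) where
  open Module M

  lincomb-δ : ∀ {r} (e : Vector Carrierᴹ r) i → lincomb M (δ A i) e ≈ᴹ e i
  lincomb-δ e zero = ≈ᴹ-trans (+ᴹ-cong (*ₗ-identityˡ _) (lincomb-zero M (e ∘ suc))) (+ᴹ-identityʳ _)
  lincomb-δ e (suc i) = ≈ᴹ-trans
    (+ᴹ-cong (*ₗ-zeroˡ _) (≈ᴹ-trans (lincomb-cong M (λ j → δ-suc i j) (λ _ → ≈ᴹ-refl)) (lincomb-δ (e ∘ suc) i)))
    (+ᴹ-identityˡ _)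
    where
    δ-suc : ∀ {r} (i j : Fin r) → CommutativeRing._≈_ A (δ A (suc i) (suc j)) (δ A i j)
    δ-suc i j with i Fin.≟ j
    ... | yes _ = CommutativeRing.refl A
    ... | no _ = CommutativeRing.refl A

-- A semilinear map whose source and target have compatible dual bases exhibits its target as
-- the base change of its source, hence carries bases to bases.
module _ {u : Level} {A B : Ring₀ u} {h : RingHom A B} {M : Mod A} {N : Mod B} (ρ : SemiLinear h M N)
  {n : ℕ} (gen : Fin n → ∣ M ∣ᴹ)
  (λ₁ : Fin n → Linear M (unitᴹ A)) (λ₂ : Fin n → Linear N (unitᴹ B))
  where
  private
    module A = CommutativeRing A
    module B = CommutativeRing B
    module M = Module M
    module N = Module N

  pushBasis :
    (∀ x → x M.≈ᴹ lincomb M (λ b → fun (λ₁ b) x) gen) →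
    (∀ y → y N.≈ᴹ lincomb N (λ b → fun (λ₂ b) y) (fun ρ ∘ gen)) →
    (∀ b x → fun (λ₂ b) (fun ρ x) B.≈ ⟦ h ⟧ (fun (λ₁ b) x)) →
    ∀ {r} {e : Fin r → ∣ M ∣ᴹ} → IsBasis M e → IsBasis N (fun ρ ∘ e)
  pushBasis expand₁ expand₂ natural {r} {e} basis = record
    { generating = λ y → (λ i → sumᴮ (λ b → fun (λ₂ b) y B.* ⟦ h ⟧ (C b i))) , N.≈ᴹ-trans (expand₂ y)
        (N.≈ᴹ-trans (lincomb-cong N (λ _ → B.refl) ρ-gen)
                     (lincomb-lincomb N (λ b → fun (λ₂ b) y) (λ b → ⟦ h ⟧ ∘ C b) (fun ρ ∘ e)))
    ; independent = independent }
    where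
    open RawMonoidDefs A.+-rawMonoid using () renaming (sum to sumᴬ)
    open RawMonoidDefs B.+-rawMonoid using () renaming (sum to sumᴮ)
    open IsBasis basis using (generating)

    C : Fin n → Vector A.Carrier r
    C b = proj₁ (generating (gen b))

    ρ-gen : ∀ b → fun ρ (gen b) N.≈ᴹ lincomb N (⟦ h ⟧ ∘ C b) (fun ρ ∘ e)
    ρ-gen b = N.≈ᴹ-trans (SemiLinear.cong ρ (proj₂ (generating (gen b)))) (fun-lincomb ρ (C b) e)

    D : Fin r → Vector A.Carrier n
    D j b = fun (λ₁ b) (e j)

    DC≈δ : ∀ j i → sumᴬ (λ b → D j b A.* C b i) A.≈ δ A j i
    DC≈δ j = coordinates-unique M basis _ _ (begin
      lincomb M (λ i → sumᴬ (λ b → D j b A.* C b i)) e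
        ≈⟨ lincomb-lincomb M (D j) C e ⟨
      lincomb M (D j) (λ b → lincomb M (C b) e)
        ≈⟨ lincomb-cong M (λ _ → A.refl) (λ b → M.≈ᴹ-sym (proj₂ (generating (gen b)))) ⟩
      lincomb M (D j) gen
        ≈⟨ expand₁ (e j) ⟨
      e j
        ≈⟨ lincomb-δ M e j ⟨
      lincomb M (δ A j) e ∎)
      where open SetoidReasoning M.≈ᴹ-setoid

    independent : ∀ d → lincomb N d (fun ρ ∘ e) N.≈ᴹ N.0ᴹ → ∀ i → d i B.≈ B.0#
    independent d p i = begin
      d i
        ≈⟨ lincomb-δ (unitᴹ B) d i ⟨
      lincomb (unitᴹ B) (δ B i) d
        ≈⟨ lincomb-comm B (δ B i) d ⟩
      lincomb (unitᴹ B) d (δ B i)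
        ≈⟨ lincomb-cong (unitᴹ B) (λ _ → B.refl) (λ j → B.sym (hDC j)) ⟩
      lincomb (unitᴹ B) d (λ j → lincomb (unitᴹ B) (⟦ h ⟧ ∘ D j) (λ b → ⟦ h ⟧ (C b i)))
        ≈⟨ lincomb-lincomb (unitᴹ B) d (λ j → ⟦ h ⟧ ∘ D j) (λ b → ⟦ h ⟧ (C b i)) ⟩
      lincomb (unitᴹ B) (λ b → sumᴮ (λ j → d j B.* ⟦ h ⟧ (D j b))) (λ b → ⟦ h ⟧ (C b i))
        ≈⟨ lincomb-cong (unitᴹ B) dD≈0 (λ _ → B.refl) ⟩
      lincomb (unitᴹ B) (λ b → B.0#) (λ b → ⟦ h ⟧ (C b i))
        ≈⟨ lincomb-zero (unitᴹ B) (λ b → ⟦ h ⟧ (C b i)) ⟩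
      B.0# ∎
      where
      open SetoidReasoning B.setoid

      hDC : ∀ j → lincomb (unitᴹ B) (⟦ h ⟧ ∘ D j) (λ b → ⟦ h ⟧ (C b i)) B.≈ δ B i j
      hDC j = B.trans (B.sym (fun-lincomb (unitMap h) (D j) (λ b → C b i)))
                (B.trans (RingHom.⟦⟧-cong h (DC≈δ j i)) (B.trans (hom-δ h j i) (δ-sym B j i)))

      dD≈0 : ∀ b → sumᴮ (λ j → d j B.* ⟦ h ⟧ (D j b)) B.≈ B.0#
      dD≈0 b = B.trans (lincomb-cong (unitᴹ B) (λ _ → B.refl) (λ j → B.sym (natural b (e j))))
        (B.trans (B.sym (fun-lincomb (λ₂ b) d (fun ρ ∘ e)))
          (B.trans (SemiLinear.cong (λ₂ b) p) (SemiLinear.0ᴹ-homo (λ₂ b))))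

abstract
  free-isLeftModule : (A : Ring₀ u) (N : ℕ) → let open CommutativeRing A in
    IsLeftModule ring (λ (v w : Vector Carrier N) → ∀ β → v β ≈ w β)
      (λ v w β → v β + w β) (λ _ → 0#) (λ v β → - v β) (λ a v β → a * v β)
  free-isLeftModule A N = record
    { isLeftSemimodule = record
      { +ᴹ-isCommutativeMonoid = record
        { isMonoid = record
          { isSemigroup = record
            { isMagma = record
              { isEquivalence = record
                { refl = λ _ → refl ; sym = λ p β → sym (p β) ; trans = λ p q β → trans (p β) (q β) }
              ; ∙-cong = λ p q β → +-cong (p β) (q β) }
            ; assoc = λ v w x β → +-assoc _ _ _ }
          ; identity = (λ v β → +-identityˡ _) , (λ v β → +-identityʳ _) }
        ; comm = λ v w β → +-comm _ _ }
      ; isPreleftSemimodule = record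
        { *ₗ-cong = λ p q β → *-cong p (q β)
        ; *ₗ-zeroˡ = λ v β → zeroˡ _
        ; *ₗ-distribʳ = λ v a b β → distribʳ _ _ _
        ; *ₗ-identityˡ = λ v β → *-identityˡ _
        ; *ₗ-assoc = λ a b v β → *-assoc _ _ _
        ; *ₗ-zeroʳ = λ a β → zeroʳ _
        ; *ₗ-distribˡ = λ a v w β → distribˡ _ _ _ } }
    ; -ᴹ‿cong = λ p β → -‿cong (p β)
    ; -ᴹ‿inverse = (λ v β → -‿inverseˡ _) , (λ v β → -‿inverseʳ _) }
    where open CommutativeRing A

Free : (A : Ring₀ u) → ℕ → Mod A
Free A N = fromLeftModule A (record
  { Carrierᴹ = Vector Carrier N
  ; _≈ᴹ_ = λ v w → ∀ β → v β ≈ w β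
  ; _+ᴹ_ = λ v w β → v β + w β
  ; _*ₗ_ = λ a v β → a * v β
  ; 0ᴹ = λ _ → 0#
  ; -ᴹ_ = λ v β → - v β
  ; isLeftModule = free-isLeftModule A N })
  where open CommutativeRing A

record Submodule {u : Level} (A : Ring₀ u) (N : ℕ) : Set (lsuc u) where
  private module F = Module (Free A N)
  field
    member : Pred (Vector ∣ A ∣ N) u
    resp   : ∀ {v w} → v F.≈ᴹ w → member v → member w
    0∈     : member F.0ᴹ
    +∈     : ∀ {v w} → member v → member w → member (v F.+ᴹ w)
    *∈     : ∀ a {v} → member v → member (a F.*ₗ v)

  -∈ : ∀ {v} → member v → member (F.-ᴹ v)
  -∈ {v} v∈ = resp (λ β → trans (sym (-‿distribˡ-* 1# (v β))) (-‿cong (*-identityˡ (v β)))) (*∈ (- 1#) v∈)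
    where
    open CommutativeRing A
    open RingProps ring using (-‿distribˡ-*)

infix 4 _∈_ _⊑_ _≐_
_∈_ : {A : Ring₀ u} {N : ℕ} → Vector ∣ A ∣ N → Submodule A N → Set u
v ∈ L = Submodule.member L v

_⊑_ _≐_ : {A : Ring₀ u} {N : ℕ} → Submodule A N → Submodule A N → Set u
L ⊑ L′ = ∀ {v} → v ∈ L → v ∈ L′
L ≐ L′ = (L ⊑ L′) × (L′ ⊑ L)

module _ {u : Level} {A : Ring₀ u} {N : ℕ} (L : Submodule A N) where
  private
    module F = Module (Free A N)
    open Submodule L

  lincomb∈ : ∀ {r} (c : Vector ∣ A ∣ r) e → (∀ i → e i ∈ L) → lincomb (Free A N) c e ∈ L
  lincomb∈ {zero}  c e e∈ = 0∈
  lincomb∈ {suc r} c e e∈ = +∈ (*∈ _ (e∈ zero)) (lincomb∈ (c ∘ suc) (e ∘ suc) (e∈ ∘ suc))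

  abstract
    sub-isLeftModule : IsLeftModule (CommutativeRing.ring A)
      (λ (v w : Σ[ v ∈ F.Carrierᴹ ] v ∈ L) → proj₁ v F.≈ᴹ proj₁ w) (λ v w → proj₁ v F.+ᴹ proj₁ w , +∈ (proj₂ v) (proj₂ w))
      (F.0ᴹ , 0∈) (λ v → F.-ᴹ proj₁ v , -∈ (proj₂ v)) (λ a v → a F.*ₗ proj₁ v , *∈ a (proj₂ v))
    sub-isLeftModule = record
      { isLeftSemimodule = record
        { +ᴹ-isCommutativeMonoid = record
          { isMonoid = record
            { isSemigroup = record
              { isMagma = record
                { isEquivalence = record { refl = F.≈ᴹ-refl ; sym = F.≈ᴹ-sym ; trans = F.≈ᴹ-trans }
                ; ∙-cong = F.+ᴹ-cong }
              ; assoc = λ v w x → F.+ᴹ-assoc _ _ _ }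
            ; identity = (λ v → F.+ᴹ-identityˡ _) , (λ v → F.+ᴹ-identityʳ _) }
          ; comm = λ v w → F.+ᴹ-comm _ _ }
        ; isPreleftSemimodule = record
          { *ₗ-cong = F.*ₗ-cong
          ; *ₗ-zeroˡ = λ v → F.*ₗ-zeroˡ _
          ; *ₗ-distribʳ = λ v → F.*ₗ-distribʳ _
          ; *ₗ-identityˡ = λ v → F.*ₗ-identityˡ _
          ; *ₗ-assoc = λ a b v → F.*ₗ-assoc a b _
          ; *ₗ-zeroʳ = F.*ₗ-zeroʳ
          ; *ₗ-distribˡ = λ a v w → F.*ₗ-distribˡ a _ _ } }
      ; -ᴹ‿cong = F.-ᴹ‿cong
      ; -ᴹ‿inverse = (λ v → F.-ᴹ‿inverseˡ _) , (λ v → F.-ᴹ‿inverseʳ _) }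

  ⟨_⟩ : Mod A
  ⟨_⟩ = fromLeftModule A (record
    { Carrierᴹ = Σ[ v ∈ F.Carrierᴹ ] v ∈ L
    ; _≈ᴹ_ = λ v w → proj₁ v F.≈ᴹ proj₁ w
    ; _+ᴹ_ = λ v w → proj₁ v F.+ᴹ proj₁ w , +∈ (proj₂ v) (proj₂ w)
    ; _*ₗ_ = λ a v → a F.*ₗ proj₁ v , *∈ a (proj₂ v)
    ; 0ᴹ = F.0ᴹ , 0∈
    ; -ᴹ_ = λ v → F.-ᴹ proj₁ v , -∈ (proj₂ v)
    ; isLeftModule = sub-isLeftModule })

  private
    _~_ : F.Carrierᴹ → F.Carrierᴹ → Set u
    v ~ w = (v F.+ᴹ (F.-ᴹ w)) ∈ L

    ≈⇒~ : ∀ {v w} → v F.≈ᴹ w → v ~ w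
    ≈⇒~ p = resp (F.≈ᴹ-sym (F.≈ᴹ-trans (F.+ᴹ-congʳ p) (F.-ᴹ‿inverseʳ _))) 0∈

    open AbelianGroupProps F.+ᴹ-abelianGroup using (⁻¹-∙-comm; ⁻¹-involutive)
    open CSP (CommutativeMonoid.commutativeSemigroup F.+ᴹ-commutativeMonoid) using (interchange)
    open SetoidReasoning F.≈ᴹ-setoid

    ~-sym : ∀ {v w} → v ~ w → w ~ v
    ~-sym {v} {w} p = resp (begin
      F.-ᴹ (v F.+ᴹ (F.-ᴹ w))      ≈⟨ ⁻¹-∙-comm _ _ ⟨
      (F.-ᴹ v) F.+ᴹ (F.-ᴹ F.-ᴹ w) ≈⟨ F.+ᴹ-congˡ (⁻¹-involutive w) ⟩
      (F.-ᴹ v) F.+ᴹ w             ≈⟨ F.+ᴹ-comm _ _ ⟩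
      w F.+ᴹ (F.-ᴹ v) ∎) (-∈ p)

    ~-trans : ∀ {v w x} → v ~ w → w ~ x → v ~ x
    ~-trans {v} {w} {x} p q = resp (begin
      (v F.+ᴹ (F.-ᴹ w)) F.+ᴹ (w F.+ᴹ (F.-ᴹ x)) ≈⟨ F.+ᴹ-assoc _ _ _ ⟩
      v F.+ᴹ ((F.-ᴹ w) F.+ᴹ (w F.+ᴹ (F.-ᴹ x))) ≈⟨ F.+ᴹ-congˡ (F.+ᴹ-assoc _ _ _) ⟨
      v F.+ᴹ (((F.-ᴹ w) F.+ᴹ w) F.+ᴹ (F.-ᴹ x)) ≈⟨ F.+ᴹ-congˡ (F.+ᴹ-congʳ (F.-ᴹ‿inverseˡ w)) ⟩
      v F.+ᴹ (F.0ᴹ F.+ᴹ (F.-ᴹ x))              ≈⟨ F.+ᴹ-congˡ (F.+ᴹ-identityˡ _) ⟩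
      v F.+ᴹ (F.-ᴹ x) ∎) (+∈ p q)

    ~-+ : ∀ {v v′ w w′} → v ~ v′ → w ~ w′ → (v F.+ᴹ w) ~ (v′ F.+ᴹ w′)
    ~-+ p q = resp (F.≈ᴹ-trans (interchange _ _ _ _) (F.+ᴹ-congˡ (⁻¹-∙-comm _ _))) (+∈ p q)

    ~-neg : ∀ {v w} → v ~ w → (F.-ᴹ v) ~ (F.-ᴹ w)
    ~-neg p = resp (F.≈ᴹ-sym (⁻¹-∙-comm _ _)) (-∈ p)

    ~-* : ∀ {a b v w} → CommutativeRing._≈_ A a b → v ~ w → (a F.*ₗ v) ~ (b F.*ₗ w)
    ~-* {a} {b} {v} {w} p q = resp
      (λ β → trans (distribˡ a (v β) (- w β)) (+-cong refl (trans (sym (-‿distribʳ-* a (w β))) (-‿cong (*-congʳ p)))))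
      (*∈ a q)
      where
      open CommutativeRing A
      open RingProps ring using (-‿distribʳ-*)

  abstract
    quotient-isLeftModule : IsLeftModule (CommutativeRing.ring A) _~_ F._+ᴹ_ F.0ᴹ F.-ᴹ_ F._*ₗ_
    quotient-isLeftModule = record
      { isLeftSemimodule = record
        { +ᴹ-isCommutativeMonoid = record
          { isMonoid = record
            { isSemigroup = record
              { isMagma = record
                { isEquivalence = record { refl = ≈⇒~ F.≈ᴹ-refl ; sym = ~-sym ; trans = ~-trans }
                ; ∙-cong = ~-+ }
              ; assoc = λ v w x → ≈⇒~ (F.+ᴹ-assoc v w x) }
            ; identity = (λ v → ≈⇒~ (F.+ᴹ-identityˡ v)) , (λ v → ≈⇒~ (F.+ᴹ-identityʳ v)) }
          ; comm = λ v w → ≈⇒~ (F.+ᴹ-comm v w) }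
        ; isPreleftSemimodule = record
          { *ₗ-cong = ~-*
          ; *ₗ-zeroˡ = λ v → ≈⇒~ (F.*ₗ-zeroˡ v)
          ; *ₗ-distribʳ = λ v a b → ≈⇒~ (F.*ₗ-distribʳ v a b)
          ; *ₗ-identityˡ = λ v → ≈⇒~ (F.*ₗ-identityˡ v)
          ; *ₗ-assoc = λ a b v → ≈⇒~ (F.*ₗ-assoc a b v)
          ; *ₗ-zeroʳ = λ a → ≈⇒~ (F.*ₗ-zeroʳ a)
          ; *ₗ-distribˡ = λ a v w → ≈⇒~ (F.*ₗ-distribˡ a v w) } }
      ; -ᴹ‿cong = ~-neg
      ; -ᴹ‿inverse = (λ v → ≈⇒~ (F.-ᴹ‿inverseˡ v)) , (λ v → ≈⇒~ (F.-ᴹ‿inverseʳ v)) }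

  Quotient : Mod A
  Quotient = fromLeftModule A (record
    { Carrierᴹ = F.Carrierᴹ
    ; _≈ᴹ_ = _~_
    ; _+ᴹ_ = F._+ᴹ_
    ; _*ₗ_ = F._*ₗ_
    ; 0ᴹ = F.0ᴹ
    ; -ᴹ_ = F.-ᴹ_
    ; isLeftModule = quotient-isLeftModule })

  inclusion : Linear ⟨_⟩ (Free A N)
  inclusion = record
    { fun = proj₁ ; cong = id ; +ᴹ-homo = λ _ _ → F.≈ᴹ-refl ; *ₗ-homo = λ _ _ → F.≈ᴹ-refl }

  projection : Linear (Free A N) Quotient
  projection = record
    { fun = id ; cong = ≈⇒~ ; +ᴹ-homo = λ _ _ → ≈⇒~ F.≈ᴹ-refl ; *ₗ-homo = λ _ _ → ≈⇒~ F.≈ᴹ-refl }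

zeroSubmodule : (A : Ring₀ u) (N : ℕ) → Submodule A N
zeroSubmodule A N = record
  { member = _≈ᴹ 0ᴹ
  ; resp = λ p q → ≈ᴹ-trans (≈ᴹ-sym p) q
  ; 0∈ = ≈ᴹ-refl
  ; +∈ = λ p q → ≈ᴹ-trans (+ᴹ-cong p q) (+ᴹ-identityˡ 0ᴹ)
  ; *∈ = λ a p → ≈ᴹ-trans (*ₗ-congˡ p) (*ₗ-zeroʳ a) }
  where open Module (Free A N)

preimage : {A : Ring₀ u} {N M : ℕ} → Linear (Free A N) (Free A M) → Submodule A M → Submodule A N
preimage {A = A} {M = M} φ L = record
  { member = λ v → fun φ v ∈ L
  ; resp = λ p → L.resp (φ.cong p)
  ; 0∈ = L.resp (≈ᴹ-sym φ.0ᴹ-homo) L.0∈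
  ; +∈ = λ p q → L.resp (≈ᴹ-sym (φ.+ᴹ-homo _ _)) (L.+∈ p q)
  ; *∈ = λ a p → L.resp (≈ᴹ-sym (φ.*ₗ-homo a _)) (L.*∈ a p) }
  where
  module L = Submodule L
  module φ = SemiLinear φ
  open Module (Free A M)

module _ {u : Level} {A B : Ring₀ u} (h : RingHom A B) {N : ℕ} where
  private module F = Module (Free B N)

  freeMap : SemiLinear h (Free A N) (Free B N)
  freeMap = record
    { fun = λ v → ⟦ h ⟧ ∘ v
    ; cong = λ p β → RingHom.⟦⟧-cong h (p β)
    ; +ᴹ-homo = λ v w β → RingHom.+-homo h _ _
    ; *ₗ-homo = λ a v β → RingHom.*-homo h _ _ }

  data Image (L : Submodule A N) : Vector ∣ B ∣ N → Set u where
    image : ∀ {v} → v ∈ L → Image L (⟦ h ⟧ ∘ v)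
    zeroᴵ : Image L F.0ᴹ
    plus  : ∀ {v w} → Image L v → Image L w → Image L (v F.+ᴹ w)
    times : ∀ b {v} → Image L v → Image L (b F.*ₗ v)
    resp  : ∀ {v w} → v F.≈ᴹ w → Image L v → Image L w

  -- the submodule of Bᴺ spanned by the image of L; for a direct summand L this is L ⊗ B
  baseChange : Submodule A N → Submodule B N
  baseChange L = record
    { member = Image L ; resp = resp ; 0∈ = zeroᴵ ; +∈ = plus ; *∈ = times }

  Image-least : ∀ {L} (L′ : Submodule B N) → (∀ {v} → v ∈ L → (⟦ h ⟧ ∘ v) ∈ L′) → baseChange L ⊑ L′
  Image-least L′ f (image v∈)   = f v∈
  Image-least L′ f zeroᴵ        = Submodule.0∈ L′
  Image-least L′ f (plus p q)   = Submodule.+∈ L′ (Image-least L′ f p) (Image-least L′ f q)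
  Image-least L′ f (times b p)  = Submodule.*∈ L′ b (Image-least L′ f p)
  Image-least L′ f (resp eq p)  = Submodule.resp L′ eq (Image-least L′ f p)

  Image-mono : {L L′ : Submodule A N} → L ⊑ L′ → baseChange L ⊑ baseChange L′
  Image-mono {L′ = L′} p = Image-least (baseChange L′) (λ v∈ → image (p v∈))

baseChange-id : {A : Ring₀ u} (h : RingHom A A) → (∀ a → CommutativeRing._≈_ A (⟦ h ⟧ a) a) →
                ∀ {N} (L : Submodule A N) → baseChange h L ≐ L
baseChange-id {A = A} h h-id L =
  Image-least h L (λ {v} v∈ → Submodule.resp L (λ β → CommutativeRing.sym A (h-id (v β))) v∈) ,
  λ {v} v∈ → resp (λ β → h-id (v β)) (image v∈)

baseChange-∘ : {A B C : Ring₀ u} (k : RingHom A C) (g : RingHom B C) (f : RingHom A B) →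
               (∀ a → CommutativeRing._≈_ C (⟦ k ⟧ a) (⟦ g ⟧ (⟦ f ⟧ a))) →
               ∀ {N} (L : Submodule A N) → baseChange k L ≐ baseChange g (baseChange f L)
baseChange-∘ {C = C} k g f k-gf {N} L =
  Image-least k (baseChange g (baseChange f L)) (λ {v} v∈ →
    resp (λ β → CommutativeRing.sym C (k-gf (v β))) (image (image v∈))) ,
  Image-least g (baseChange k L) (Image-least f (record
    { member = λ v → (⟦ g ⟧ ∘ v) ∈ baseChange k L
    ; resp = λ p → resp (g.cong p)
    ; 0∈ = resp (F.≈ᴹ-sym g.0ᴹ-homo) zeroᴵ
    ; +∈ = λ p q → resp (F.≈ᴹ-sym (g.+ᴹ-homo _ _)) (plus p q)
    ; *∈ = λ a p → resp (F.≈ᴹ-sym (g.*ₗ-homo a _)) (times (⟦ g ⟧ a) p) })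
    (λ {v} v∈ → resp (λ β → k-gf (v β)) (image v∈)))
  where
  module F = Module (Free C N)
  module g = SemiLinear (freeMap g {N})

-- A retraction onto L, recorded by the images of the standard basis vectors.
record Retraction {u : Level} {A : Ring₀ u} {N : ℕ} (L : Submodule A N) : Set u where
  open Module (Free A N)
  field
    column   : Fin N → Carrierᴹ
    column∈  : ∀ β → column β ∈ L
    retracts : ∀ {v} → v ∈ L → lincomb (Free A N) v column ≈ᴹ v

module _ {u : Level} (A : Ring₀ u) {N : ℕ} where
  private module A = CommutativeRing A
  open Module (Free A N)

  free-expand : (v : Vector ∣ A ∣ N) → lincomb (Free A N) v (δ A) ≈ᴹ v
  free-expand v β = A.trans (component v (δ A) β)
    (A.trans (flip-δ v β) (lincomb-δ (unitᴹ A) v β))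
    where
    component : ∀ {r} (c : Vector ∣ A ∣ r) (e : Fin r → Vector ∣ A ∣ N) β →
                lincomb (Free A N) c e β A.≈ lincomb (unitᴹ A) c (λ i → e i β)
    component {zero}  c e β = A.refl
    component {suc r} c e β = A.+-cong A.refl (component (c ∘ suc) (e ∘ suc) β)

    flip-δ : (v : Vector ∣ A ∣ N) → ∀ β →
             lincomb (unitᴹ A) v (λ i → δ A i β) A.≈ lincomb (unitᴹ A) (δ A β) v
    flip-δ v β = A.trans (lincomb-cong (unitᴹ A) (λ _ → A.refl) (λ i → δ-sym A i β))
                   (lincomb-comm A v (δ A β))

module _ {u : Level} {A : Ring₀ u} {N : ℕ} where
  private module A = CommutativeRing A
  open Module (Free A N)

  coordinate : Fin N → Linear (Free A N) (unitᴹ A)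
  coordinate β = record
    { fun = λ v → v β ; cong = λ p → p β ; +ᴹ-homo = λ _ _ → A.refl ; *ₗ-homo = λ _ _ → A.refl }

  standardBasis : Basis (Free A N) N
  standardBasis = δ A , record
    { generating = λ v → v , ≈ᴹ-sym (free-expand A v)
    ; independent = λ c p β → A.trans (A.sym (free-expand A c β)) (p β) }

  retraction-resp : {L L′ : Submodule A N} → L ≐ L′ → Retraction L → Retraction L′
  retraction-resp (L⊑L′ , L′⊑L) R = record
    { column = column ; column∈ = λ β → L⊑L′ (column∈ β) ; retracts = λ v∈ → retracts (L′⊑L v∈) }
    where open Retraction R

  module _ (L : Submodule A N) (R : Retraction L) where
    open Retraction R
    private module L = Module ⟨ L ⟩
    private module Q = Module (Quotient L)

    restrictCoordinate : Fin N → Linear ⟨ L ⟩ (unitᴹ A)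
    restrictCoordinate β = record
      { fun = λ v → proj₁ v β ; cong = λ p → p β ; +ᴹ-homo = λ _ _ → A.refl ; *ₗ-homo = λ _ _ → A.refl }

    sub-expand : (v : L.Carrierᴹ) →
                 v L.≈ᴹ lincomb ⟨ L ⟩ (proj₁ v) (λ β → column β , column∈ β)
    sub-expand v = ≈ᴹ-trans (≈ᴹ-sym (retracts (proj₂ v)))
      (≈ᴹ-sym (fun-lincomb (inclusion L) (proj₁ v) (λ β → column β , column∈ β)))

    retract : Carrierᴹ → Carrierᴹ
    retract v = lincomb (Free A N) v column

    retract-- : ∀ v w → retract (v +ᴹ -ᴹ w) ≈ᴹ (retract v +ᴹ -ᴹ retract w)
    retract-- v w = ≈ᴹ-trans (lincomb-+ (Free A N) v (-ᴹ w) column)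
      (+ᴹ-congˡ (λ β → A.trans (scale β) (A.trans (A.sym (-‿distribˡ-* A.1# _)) (A.-‿cong (A.*-identityˡ _)))))
      where
      open RingProps A.ring using (-‿distribˡ-*)
      scale : retract (-ᴹ w) ≈ᴹ ((A.- A.1#) *ₗ retract w)
      scale = ≈ᴹ-trans
        (lincomb-cong (Free A N) {f = column}
          (λ i → A.trans (A.-‿cong (A.sym (A.*-identityˡ (w i)))) (-‿distribˡ-* A.1# (w i)))
          (λ _ → ≈ᴹ-refl))
        (lincomb-* (Free A N) (A.- A.1#) w column)

    cokernelCoordinate : Fin N → Linear (Quotient L) (unitᴹ A)
    cokernelCoordinate β = record
      { fun = λ v → v β A.- retract v β
      ; cong = λ {v} {w} p → x∙y⁻¹≈ε⇒x≈y _ _ (A.trans (split v w) (A.trans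
          (A.+-cong A.refl (A.-‿cong (A.sym (retract-- v w β))))
          (A.trans (A.+-cong A.refl (A.-‿cong (retracts p β))) (A.-‿inverseʳ _))))
      ; +ᴹ-homo = λ v w → A.trans
          (A.+-cong A.refl (A.trans (A.-‿cong (lincomb-+ (Free A N) v w column β)) (A.sym (⁻¹-∙-comm _ _))))
          (interchange _ _ _ _)
      ; *ₗ-homo = λ a v → A.trans
          (A.+-cong A.refl (A.trans (A.-‿cong (lincomb-* (Free A N) a v column β)) (-‿distribʳ-* _ _)))
          (A.sym (A.distribˡ _ _ _)) }
      where
      open RingProps A.ring using (-‿distribʳ-*)
      open AbelianGroupProps A.+-abelianGroup using (⁻¹-∙-comm; x∙y⁻¹≈ε⇒x≈y)
      open CSP (CommutativeMonoid.commutativeSemigroup A.+-commutativeMonoid) using (interchange)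

      split : ∀ v w → (v β A.- retract v β) A.- (w β A.- retract w β) A.≈
                      (v β A.- w β) A.- (retract v β A.- retract w β)
      split v w = A.trans (A.+-cong A.refl (A.sym (⁻¹-∙-comm _ _)))
        (A.trans (interchange _ _ _ _) (A.+-cong A.refl (⁻¹-∙-comm _ _)))

    quotient-expand : ∀ v → v Q.≈ᴹ lincomb (Quotient L) (λ β → fun (cokernelCoordinate β) v) (δ A)
    quotient-expand v = Submodule.resp L
      (λ β → A.sym (A.trans (A.+-cong A.refl (A.-‿cong (free-expand A (λ γ → v γ A.- retract v γ) β)))
        (difference (v β) (retract v β))))
      (lincomb∈ L v column column∈)
      where
      open AbelianGroupProps A.+-abelianGroup using (⁻¹-∙-comm; ⁻¹-involutive)
      difference : ∀ a b → a A.- (a A.- b) A.≈ b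
      difference a b = A.trans (A.+-cong A.refl (A.sym (⁻¹-∙-comm a (A.- b))))
        (A.trans (A.sym (A.+-assoc _ _ _))
          (A.trans (A.+-cong (A.-‿inverseʳ a) (⁻¹-involutive b)) (A.+-identityˡ b)))

module _ {u : Level} {A B : Ring₀ u} (h : RingHom A B) {N : ℕ} where
  private
    module A = CommutativeRing A
    module B = CommutativeRing B
    module F = Module (Free B N)

  baseChangeRetraction : {L : Submodule A N} → Retraction L → Retraction (baseChange h L)
  baseChangeRetraction {L} R = record
    { column = λ β → ⟦ h ⟧ ∘ column β
    ; column∈ = λ β → image (column∈ β)
    ; retracts = Image-least h fixed (λ {v} v∈ →
        F.≈ᴹ-trans (F.≈ᴹ-sym (fun-lincomb (freeMap h) v column)) (SemiLinear.cong (freeMap h) (retracts v∈))) }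
    where
    open Retraction R
    hc : Fin N → F.Carrierᴹ
    hc β = ⟦ h ⟧ ∘ column β

    P : F.Carrierᴹ → F.Carrierᴹ
    P v = lincomb (Free B N) v hc

    fixed : Submodule B N
    fixed = record
      { member = λ v → P v F.≈ᴹ v
      ; resp = λ p q → F.≈ᴹ-trans (lincomb-cong (Free B N) (λ β → B.sym (p β)) (λ _ → F.≈ᴹ-refl)) (F.≈ᴹ-trans q p)
      ; 0∈ = lincomb-zero (Free B N) hc
      ; +∈ = λ {v} {w} p q → F.≈ᴹ-trans (lincomb-+ (Free B N) v w hc) (F.+ᴹ-cong p q)
      ; *∈ = λ b {v} p → F.≈ᴹ-trans (lincomb-* (Free B N) b v hc) (F.*ₗ-congˡ p) }

  module _ (L : Submodule A N) (L′ : Submodule B N) (maps : ∀ {v} → v ∈ L → (⟦ h ⟧ ∘ v) ∈ L′) where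

    subMap : SemiLinear h ⟨ L ⟩ ⟨ L′ ⟩
    subMap = record
      { fun = λ v → ⟦ h ⟧ ∘ proj₁ v , maps (proj₂ v)
      ; cong = SemiLinear.cong (freeMap h)
      ; +ᴹ-homo = λ v w → SemiLinear.+ᴹ-homo (freeMap h) (proj₁ v) (proj₁ w)
      ; *ₗ-homo = λ a v → SemiLinear.*ₗ-homo (freeMap h) a (proj₁ v) }

    quotientMap : SemiLinear h (Quotient L) (Quotient L′)
    quotientMap = record
      { fun = λ v → ⟦ h ⟧ ∘ v
      ; cong = λ p → Submodule.resp L′
          (λ β → B.trans (RingHom.+-homo h _ _) (B.+-cong B.refl (RingHom.-‿homo h _))) (maps p)
      ; +ᴹ-homo = λ v w → SemiLinear.cong (projection L′) (SemiLinear.+ᴹ-homo (freeMap h) v w)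
      ; *ₗ-homo = λ a v → SemiLinear.cong (projection L′) (SemiLinear.*ₗ-homo (freeMap h) a v) }

    module _ (R : Retraction L) (R′ : Retraction L′)
      (columns : ∀ β → Retraction.column R′ β F.≈ᴹ (⟦ h ⟧ ∘ Retraction.column R β)) where
      private
        module R = Retraction R
        module R′ = Retraction R′

      subMap-expand : ∀ v → Module._≈ᴹ_ ⟨ L′ ⟩ v
        (lincomb ⟨ L′ ⟩ (proj₁ v) (λ β → fun subMap (R.column β , R.column∈ β)))
      subMap-expand v = F.≈ᴹ-trans (sub-expand L′ R′ v)
        (lincomb-cong ⟨ L′ ⟩ (λ _ → B.refl) columns)

      quotientMap-expand : ∀ v → Module._≈ᴹ_ (Quotient L′) v
        (lincomb (Quotient L′) (λ β → fun (cokernelCoordinate L′ R′ β) v) (λ β → ⟦ h ⟧ ∘ δ A β))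
      quotientMap-expand v = Module.≈ᴹ-trans (Quotient L′) (quotient-expand L′ R′ v)
        (lincomb-cong (Quotient L′) (λ _ → B.refl)
          (λ β → SemiLinear.cong (projection L′) (λ γ → B.sym (hom-δ h β γ))))

      cokernelCoordinate-natural : ∀ β v →
        fun (cokernelCoordinate L′ R′ β) (⟦ h ⟧ ∘ v) B.≈ ⟦ h ⟧ (fun (cokernelCoordinate L R β) v)
      cokernelCoordinate-natural β v = B.sym (B.trans (RingHom.+-homo h _ _)
        (B.+-cong B.refl (B.trans (RingHom.-‿homo h _) (B.-‿cong (B.trans
          (fun-lincomb (freeMap h) v R.column β)
          (lincomb-cong (Free B N) (λ _ → B.refl) (λ γ → F.≈ᴹ-sym (columns γ)) β))))))

      pushSubBasis : ∀ {r} → Basis ⟨ L ⟩ r → Basis ⟨ L′ ⟩ r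
      pushSubBasis (e , basis) = fun subMap ∘ e ,
        pushBasis subMap (λ β → R.column β , R.column∈ β)
          (restrictCoordinate L R) (restrictCoordinate L′ R′)
          (sub-expand L R) subMap-expand (λ _ _ → B.refl) basis

      pushQuotientBasis : ∀ {r} → Basis (Quotient L) r → Basis (Quotient L′) r
      pushQuotientBasis (e , basis) = fun quotientMap ∘ e ,
        pushBasis quotientMap (δ A)
          (cokernelCoordinate L R) (cokernelCoordinate L′ R′)
          (quotient-expand L R) quotientMap-expand cokernelCoordinate-natural basis

-- An A-valued point of the Grassmannian Gr(r, Kᴺ): a direct summand of Aᴺ of rank r, i.e. one
-- which, together with the quotient by it, is free Zariski locally on Spec A, of ranks r and N - r.
record Summand {u : Level} (r N : ℕ) (A : Ring₀ u) : Set (lsuc u) where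
  field
    L          : Submodule A N
    retraction : Retraction L
    {charts}   : ℕ
    opens      : Vector ∣ A ∣ charts
    cover      : UnitIdeal A opens
    free       : ∀ j → Basis ⟨ baseChange (localize A (opens j)) L ⟩ r
    cofree     : ∀ j → Basis (Quotient (baseChange (localize A (opens j)) L)) (N ∸ r)

module _ {u : Level} {A A′ B B′ : Ring₀ u}
  (i : RingHom A A′) (h : RingHom A B) (i′ : RingHom B B′) (k : RingHom A′ B′)
  (square : ∀ a → CommutativeRing._≈_ B′ (⟦ i′ ⟧ (⟦ h ⟧ a)) (⟦ k ⟧ (⟦ i ⟧ a)))
  {N : ℕ} (L : Submodule A N) (R : Retraction L) where
  private
    module L₂ = Submodule (baseChange i′ (baseChange h L))
    module F = Module (Free B′ N)
    module k = SemiLinear (freeMap k {N})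

    maps : ∀ {v} → v ∈ baseChange i L → (⟦ k ⟧ ∘ v) ∈ baseChange i′ (baseChange h L)
    maps = Image-least i (record
      { member = λ v → (⟦ k ⟧ ∘ v) ∈ baseChange i′ (baseChange h L)
      ; resp = λ p → L₂.resp (k.cong p)
      ; 0∈ = L₂.resp (F.≈ᴹ-sym k.0ᴹ-homo) L₂.0∈
      ; +∈ = λ p q → L₂.resp (F.≈ᴹ-sym (k.+ᴹ-homo _ _)) (L₂.+∈ p q)
      ; *∈ = λ a p → L₂.resp (F.≈ᴹ-sym (k.*ₗ-homo a _)) (L₂.*∈ (⟦ k ⟧ a) p) })
      (λ {v} v∈ → L₂.resp (λ γ → square (v γ)) (image (image v∈)))

    columns : ∀ β → Retraction.column (baseChangeRetraction i′ (baseChangeRetraction h R)) β F.≈ᴹ (⟦ k ⟧ ∘ Retraction.column (baseChangeRetraction i R) β)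
    columns β γ = square (Retraction.column R β γ)

  squareSubBasis : ∀ {r} → Basis ⟨ baseChange i L ⟩ r → Basis ⟨ baseChange i′ (baseChange h L) ⟩ r
  squareSubBasis = pushSubBasis k (baseChange i L) (baseChange i′ (baseChange h L)) maps (baseChangeRetraction i R) (baseChangeRetraction i′ (baseChangeRetraction h R)) columns

  squareQuotientBasis : ∀ {r} → Basis (Quotient (baseChange i L)) r → Basis (Quotient (baseChange i′ (baseChange h L))) r
  squareQuotientBasis = pushQuotientBasis k (baseChange i L) (baseChange i′ (baseChange h L)) maps (baseChangeRetraction i R) (baseChangeRetraction i′ (baseChangeRetraction h R)) columns

module _ {u : Level} {A B : Ring₀ u} (h : RingHom A B) where
  private
    module A = CommutativeRing A
    module B = CommutativeRing B

  unitIdeal-hom : ∀ {m} {f : Vector ∣ A ∣ m} → UnitIdeal A f → UnitIdeal B (⟦ h ⟧ ∘ f)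
  unitIdeal-hom {f = f} (a , p) = ⟦ h ⟧ ∘ a ,
    B.trans (B.sym (fun-lincomb (unitMap h) a f)) (B.trans (RingHom.⟦⟧-cong h p) (RingHom.1#-homo h))

  awaySubBasis : ∀ {r N} (f : ∣ A ∣) (L : Submodule A N) → Retraction L →
    Basis ⟨ baseChange (localize A f) L ⟩ r →
    Basis ⟨ baseChange (localize B (⟦ h ⟧ f)) (baseChange h L) ⟩ r
  awaySubBasis f L R = squareSubBasis {A = A} {A [1/ f ]} {B} {B [1/ ⟦ h ⟧ f ]}
    (localize A f) h (localize B (⟦ h ⟧ f)) (awayMap h f) (away-square h f) L R

  awayQuotientBasis : ∀ {r N} (f : ∣ A ∣) (L : Submodule A N) → Retraction L →
    Basis (Quotient (baseChange (localize A f) L)) r →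
    Basis (Quotient (baseChange (localize B (⟦ h ⟧ f)) (baseChange h L))) r
  awayQuotientBasis f L R = squareQuotientBasis {A = A} {A [1/ f ]} {B} {B [1/ ⟦ h ⟧ f ]}
    (localize A f) h (localize B (⟦ h ⟧ f)) (awayMap h f) (away-square h f) L R

  pushSummand : ∀ {r N} → Summand r N A → Summand r N B
  pushSummand {r} {N} x = record
    { L = baseChange h L
    ; retraction = baseChangeRetraction h retraction
    ; opens = λ j → ⟦ h ⟧ (opens j)
    ; cover = unitIdeal-hom cover
    ; free = λ j → awaySubBasis (opens j) L retraction (free j)
    ; cofree = λ j → awayQuotientBasis (opens j) L retraction (cofree j) }
    where open Summand x

unitIdeal-1 : (A : Ring₀ u) → UnitIdeal A {1} (λ _ → CommutativeRing.1# A)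
unitIdeal-1 A = (λ _ → 1#) , trans (+-identityʳ _) (*-identityˡ 1#)
  where open CommutativeRing A

baseChange-zero : {A B : Ring₀ u} (h : RingHom A B) {N : ℕ} →
                  baseChange h (zeroSubmodule A N) ⊑ zeroSubmodule B N
baseChange-zero {B = B} h {N} = Image-least h (zeroSubmodule B N)
  (λ p β → CommutativeRing.trans B (RingHom.⟦⟧-cong h (p β)) (RingHom.0#-homo h))

zeroSummand : (A : Ring₀ u) (N : ℕ) → Summand 0 N A
zeroSummand A N = record
  { L = zeroSubmodule A N
  ; retraction = record
    { column = λ _ → 0ᴹ
    ; column∈ = λ _ → ≈ᴹ-refl
    ; retracts = λ {v} v≈0 → ≈ᴹ-trans (lincomb-cong (Free A N) {e = λ _ → 0ᴹ} v≈0 (λ _ → ≈ᴹ-refl))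
        (≈ᴹ-trans (lincomb-zero (Free A N) {N} (λ _ → 0ᴹ)) (≈ᴹ-sym v≈0)) }
  ; opens = λ _ → CommutativeRing.1# A
  ; cover = unitIdeal-1 A
  ; free = λ _ → (λ ()) , record
      { generating = λ (v , v∈) → (λ ()) , baseChange-zero ι v∈
      ; independent = λ _ _ () }
  ; cofree = λ _ → δ A₁ , record
      { generating = λ v → v , SemiLinear.cong (projection L₁) (Module.≈ᴹ-sym (Free A₁ N) (free-expand A₁ v))
      ; independent = λ c p β → A₁.trans (A₁.sym (free-expand A₁ c β)) (minus-zero (baseChange-zero ι p β)) } }
  where
  open Module (Free A N)
  A₁ = A [1/ CommutativeRing.1# A ]
  module A₁ = CommutativeRing A₁
  ι = localize A (CommutativeRing.1# A)
  L₁ = baseChange ι (zeroSubmodule A N)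

  minus-zero : ∀ {a} → a A₁.- A₁.0# A₁.≈ A₁.0# → a A₁.≈ A₁.0#
  minus-zero = AbelianGroupProps.x∙y⁻¹≈ε⇒x≈y A₁.+-abelianGroup _ _
Monotone : ∀ {l m} → Vec (Fin m) l → Set
Monotone α = ∀ i j → i Fin.≤ j → Vec.lookup α i Fin.≤ Vec.lookup α j

monotone? : ∀ {l m} → Decidable (Monotone {l} {m})
monotone? α = Fin.all? (λ i → Fin.all? (λ j → (i Fin.≤? j) →-dec (Vec.lookup α i Fin.≤? Vec.lookup α j)))

vecs : ∀ m l → List (Vec (Fin m) l)
vecs m zero    = Vec.[] ∷ []
vecs m (suc l) = cartesianProductWith Vec._∷_ (allFin m) (vecs m l)

-- the nondecreasing maps [p] → [n], each once
simplices : (n p : ℕ) → List (Vec (Fin (suc n)) (suc p))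
simplices n p = filter monotone? (vecs (suc n) (suc p))

dimC : (n p : ℕ) → ℕ
dimC n p = length (simplices n p)

simplex : (n p : ℕ) → Fin (dimC n p) → Vec (Fin (suc n)) (suc p)
simplex n p = lookup (simplices n p)

vecs-complete : ∀ {m l} (α : Vec (Fin m) l) → α List.∈ vecs m l
vecs-complete Vec.[]      = here ≡.refl
vecs-complete (x Vec.∷ α) = ∈-cartesianProductWith⁺ Vec._∷_ (∈-allFin x) (vecs-complete α)

simplices-complete : ∀ {n p} {α : Vec (Fin (suc n)) (suc p)} → Monotone α → α List.∈ simplices n p
simplices-complete {α = α} mono = ∈-filter⁺ monotone? (vecs-complete α) mono

simplices-monotone : ∀ {n p} {α : Vec (Fin (suc n)) (suc p)} → α List.∈ simplices n p → Monotone α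
simplices-monotone {n} {p} α∈ = proj₂ (∈-filter⁻ monotone? {xs = vecs (suc n) (suc p)} α∈)

vecs-unique : ∀ m l → Unique (vecs m l)
vecs-unique m zero    = [] ∷ []
vecs-unique m (suc l) = Unique.cartesianProductWith⁺ Vec._∷_ Vec.∷-injective (Unique.allFin⁺ m) (vecs-unique m l)

simplices-unique : ∀ n p → Unique (simplices n p)
simplices-unique n p = Unique.filter⁺ monotone? (vecs-unique (suc n) (suc p))

-- In coordinates, dᵢ : C_{p+1} → C_p sends the basis vector α to the basis vector α ∘ δᵢ.
face : (A : Ring₀ u) (n p : ℕ) → Fin (suc (suc p)) → Fin (dimC n (suc p)) → Vector ∣ A ∣ (dimC n p)
face A n p i a b =
  if does (Vec.≡-dec Fin._≟_ (Vec.tabulate (Vec.lookup (simplex n (suc p) a) ∘ punchIn i)) (simplex n p b))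
  then 1# else 0#
  where open CommutativeRing A

-- α on the first p elements, the order isomorphism from the last e elements to the last e elements
extend : ∀ {p q} e → (Fin p → Fin q) → Fin (p ℕ.+ e) → Fin (q ℕ.+ e)
extend {p} {q} e α x = join q e (⊎.map₁ α (splitAt p x))

extend-id : ∀ {p} e → extend {p} e id ≗ id
extend-id {p} e x with splitAt p x in eq
... | inj₁ i = ≡.trans (≡.cong (join p e) (≡.sym eq)) (Fin.join-splitAt p e x)
... | inj₂ j = ≡.trans (≡.cong (join p e) (≡.sym eq)) (Fin.join-splitAt p e x)

extend-∘ : ∀ {p q r} e (β : Fin q → Fin r) (α : Fin p → Fin q) → extend e (β ∘ α) ≗ extend e β ∘ extend e α
extend-∘ {p} {q} e β α x with splitAt p x
... | inj₁ i rewrite Fin.splitAt-↑ˡ q (α i) e = ≡.refl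
... | inj₂ j rewrite Fin.splitAt-↑ʳ q e j = ≡.refl

extend-punchIn : ∀ {p} e (i : Fin (suc p)) → extend e (punchIn i) ≗ punchIn (i ↑ˡ e)
extend-punchIn {p} e zero x = ≡.trans (lemma (splitAt p x)) (≡.cong suc (Fin.join-splitAt p e x))
  where
  lemma : ∀ y → join (suc p) e (⊎.map₁ suc y) ≡ suc (join p e y)
  lemma (inj₁ _) = ≡.refl
  lemma (inj₂ _) = ≡.refl
extend-punchIn {suc p} e (suc i) zero = ≡.refl
extend-punchIn {suc p} e (suc i) (suc x) = ≡.trans (lemma (splitAt p x)) (≡.cong suc (extend-punchIn e i x))
  where
  lemma : ∀ y → join (suc (suc p)) e (⊎.map₁ (punchIn (suc i)) (⊎.map₁ suc y)) ≡
                suc (join (suc p) e (⊎.map₁ (punchIn i) y))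
  lemma (inj₁ _) = ≡.refl
  lemma (inj₂ _) = ≡.refl

extend-pinch : ∀ {p} e (i : Fin p) → extend e (pinch i) ≗ pinch (i ↑ˡ e)
extend-pinch {suc p} e zero    zero = ≡.refl
extend-pinch {suc p} e (suc i) zero = ≡.refl
extend-pinch {suc p} e zero (suc x) = ≡.trans (lemma (splitAt (suc p) x)) (Fin.join-splitAt (suc p) e x)
  where
  lemma : ∀ y → join (suc p) e (⊎.map₁ (pinch zero) (⊎.map₁ suc y)) ≡ join (suc p) e y
  lemma (inj₁ _) = ≡.refl
  lemma (inj₂ _) = ≡.refl
extend-pinch {suc p} e (suc i) (suc x) = ≡.trans (lemma (splitAt (suc p) x)) (≡.cong suc (extend-pinch e i x))
  where
  lemma : ∀ y → join (suc p) e (⊎.map₁ (pinch (suc i)) (⊎.map₁ suc y)) ≡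
                suc (join p e (⊎.map₁ (pinch i) y))
  lemma (inj₁ _) = ≡.refl
  lemma (inj₂ _) = ≡.refl

module Format {k : ℕ} (s : Vector ℕ (suc k)) where

  n : ℕ
  n = foldr _⊓_ (s zero) s ∸ 1

  excess : Fin (suc k) → ℕ
  excess a = s a ∸ 1 ∸ n

  -- n_a - 1 - n + p, where n_a - 1 - n ≥ 0
  M : Fin (suc k) → ℕ → ℕ
  M a p = p ℕ.+ excess a

  I : ℕ → Set
  I p = ∀ a → Fin (suc (M a p))

  I₁ : ∀ {p q} → (Fin (suc p) → Fin (suc q)) → I p → I q
  I₁ α m a = extend (excess a) α (m a)

  -- I₁ is a functor with the prescribed values on cofaces and codegeneracies; as these generate
  -- the simplex category, it is the only one.
  I₁-id : ∀ {p} (m : I p) a → I₁ id m a ≡ m a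
  I₁-id m a = extend-id (excess a) (m a)

  I₁-∘ : ∀ {p q r} (β : Fin (suc q) → Fin (suc r)) (α : Fin (suc p) → Fin (suc q)) m a →
         I₁ (β ∘ α) m a ≡ I₁ β (I₁ α m) a
  I₁-∘ β α m a = extend-∘ (excess a) β α (m a)

  I₁-δ : ∀ {p} (i : Fin (suc (suc p))) m a → I₁ (punchIn i) m a ≡ punchIn (i ↑ˡ excess a) (m a)
  I₁-δ i m a = extend-punchIn (excess a) i (m a)

  I₁-σ : ∀ {p} (i : Fin (suc p)) m a → I₁ (pinch i) m a ≡ pinch (i ↑ˡ excess a) (m a)
  I₁-σ i m a = extend-pinch (excess a) i (m a)

  -- Rows m ∈ I_p, columns the nondecreasing maps α : [p] → [n], entries T(I_•(α)(m)).
  matrix : {F : Set u} → (I n → F) → (p : ℕ) → I p → Fin (dimC n p) → F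
  matrix T p m a = T (I₁ (Vec.lookup (simplex n p a)) m)

-- The free commutative K-algebra on a setoid of variables.
module Polynomial {u : Level} (K : CommutativeRing u u) (V : Setoid 0ℓ 0ℓ) where
  private
    module K = CommutativeRing K
    module V = Setoid V

  infixl 6 _⊕_
  infixl 7 _⊗_
  data Poly : Set u where
    con     : K.Carrier → Poly
    var     : V.Carrier → Poly
    _⊕_ _⊗_ : Poly → Poly → Poly
    ⊝_      : Poly → Poly

  infix 4 _≈ᴾ_
  data _≈ᴾ_ : Poly → Poly → Set u where
    ≈-refl    : ∀ {f} → f ≈ᴾ f
    ≈-sym     : ∀ {f g} → f ≈ᴾ g → g ≈ᴾ f
    ≈-trans   : ∀ {f g h} → f ≈ᴾ g → g ≈ᴾ h → f ≈ᴾ h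
    con-cong  : ∀ {a b} → a K.≈ b → con a ≈ᴾ con b
    var-cong  : ∀ {x y} → x V.≈ y → var x ≈ᴾ var y
    ⊕-cong    : ∀ {f f′ g g′} → f ≈ᴾ f′ → g ≈ᴾ g′ → f ⊕ g ≈ᴾ f′ ⊕ g′
    ⊗-cong    : ∀ {f f′ g g′} → f ≈ᴾ f′ → g ≈ᴾ g′ → f ⊗ g ≈ᴾ f′ ⊗ g′
    ⊝-cong    : ∀ {f f′} → f ≈ᴾ f′ → ⊝ f ≈ᴾ ⊝ f′
    con-+     : ∀ a b → con (a K.+ b) ≈ᴾ con a ⊕ con b
    con-*     : ∀ a b → con (a K.* b) ≈ᴾ con a ⊗ con b
    ⊕-assoc   : ∀ f g h → (f ⊕ g) ⊕ h ≈ᴾ f ⊕ (g ⊕ h)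
    ⊕-comm    : ∀ f g → f ⊕ g ≈ᴾ g ⊕ f
    ⊕-0       : ∀ f → con K.0# ⊕ f ≈ᴾ f
    ⊝-inverse : ∀ f → ⊝ f ⊕ f ≈ᴾ con K.0#
    ⊗-assoc   : ∀ f g h → (f ⊗ g) ⊗ h ≈ᴾ f ⊗ (g ⊗ h)
    ⊗-comm    : ∀ f g → f ⊗ g ≈ᴾ g ⊗ f
    ⊗-1       : ∀ f → con K.1# ⊗ f ≈ᴾ f
    ⊗-⊕       : ∀ f g h → f ⊗ (g ⊕ h) ≈ᴾ (f ⊗ g) ⊕ (f ⊗ h)

  polynomialRing : CommutativeRing u u
  polynomialRing = record
    { Carrier = Poly ; _≈_ = _≈ᴾ_ ; _+_ = _⊕_ ; _*_ = _⊗_ ; -_ = ⊝_ ; 0# = con K.0# ; 1# = con K.1#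
    ; isCommutativeRing = record
      { isRing = record
        { +-isAbelianGroup = record
          { isGroup = record
            { isMonoid = record
              { isSemigroup = record
                { isMagma = record
                  { isEquivalence = record { refl = ≈-refl ; sym = ≈-sym ; trans = ≈-trans }
                  ; ∙-cong = ⊕-cong }
                ; assoc = ⊕-assoc }
              ; identity = ⊕-0 , λ f → ≈-trans (⊕-comm f _) (⊕-0 f) }
            ; inverse = ⊝-inverse , λ f → ≈-trans (⊕-comm f _) (⊝-inverse f)
            ; ⁻¹-cong = ⊝-cong }
          ; comm = ⊕-comm }
        ; *-cong = ⊗-cong
        ; *-assoc = ⊗-assoc
        ; *-identity = ⊗-1 , λ f → ≈-trans (⊗-comm f _) (⊗-1 f)
        ; distrib = ⊗-⊕ , λ f g h → ≈-trans (⊗-comm _ f)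
            (≈-trans (⊗-⊕ f g h) (⊕-cong (⊗-comm f g) (⊗-comm f h))) }
      ; *-comm = ⊗-comm } }

-- The total ring of fractions; for an integral domain the denominators are the nonzero elements.
module Fractions {u : Level} (A : CommutativeRing u u) where
  open CommutativeRing A

  Regular : Pred Carrier u
  Regular a = ∀ b → a * b ≈ 0# → b ≈ 0#

  1-regular : Regular 1#
  1-regular b p = trans (sym (*-identityˡ b)) p

  *-regular : ∀ {s t} → Regular s → Regular t → Regular (s * t)
  *-regular {s} {t} s∈ t∈ b p = t∈ b (s∈ (t * b) (trans (sym (*-assoc s t b)) p))

  open Localization A Regular 1-regular *-regular
    public using (fromRing) renaming (localization to fractionRing)

-- The rank of a matrix over a field F, given by its columns: some r of them form a basis of
-- the column space.
IsRank : (F : Ring₀ u) {rows : Set} {c : ℕ} → (rows → Fin c → ∣ F ∣) → ℕ → Set u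
IsRank F {rows} {c} M r = Σ[ σ ∈ (Fin r → Fin c) ]
  (∀ d → (∀ m → lincomb (unitᴹ F) d (λ j → M m (σ j)) ≈ 0#) → ∀ j → d j ≈ 0#) ×
  (∀ b → ∃[ d ] ∀ m → M m b ≈ lincomb (unitᴹ F) d (λ j → M m (σ j)))
  where open CommutativeRing F

module Generic {u : Level} (K : CommutativeRing u u) {k : ℕ} (s : Vector ℕ (suc k)) where
  open Format s

  variables : Setoid 0ℓ 0ℓ
  variables = record
    { Carrier = I n
    ; _≈_ = λ v w → ∀ a → v a ≡ w a
    ; isEquivalence = record
      { refl = λ a → ≡.refl ; sym = λ p a → ≡.sym (p a) ; trans = λ p q a → ≡.trans (p a) (q a) } }

  open Polynomial K variables
  open Fractions polynomialRing

  IsGenericRank : ℕ → ℕ → Set u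
  IsGenericRank p r = IsRank fractionRing (matrix (λ v → fromRing (var v)) p) r

module Geometry {u : Level} (K : CommutativeRing u u) where

  record Algebra : Set (lsuc u) where
    field
      ring      : Ring₀ u
      structure : RingHom K ring
    open CommutativeRing ring public using (Carrier; _≈_; 0#)

  open Algebra using (ring; structure)

  record _⟶_ (A B : Algebra) : Set u where
    field
      hom       : RingHom (ring A) (ring B)
      structure-homo : ∀ a → Algebra._≈_ B (⟦ hom ⟧ (⟦ structure A ⟧ a)) (⟦ structure B ⟧ a)

  open _⟶_ public

  idᴬ : ∀ {A} → A ⟶ A
  idᴬ {A} = record { hom = idHom ; structure-homo = λ _ → CommutativeRing.refl (ring A) }

  Is-id : ∀ {A} → A ⟶ A → Set u
  Is-id {A} f = ∀ a → Algebra._≈_ A (⟦ hom f ⟧ a) a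

  Is-∘ : ∀ {A B C} → A ⟶ C → B ⟶ C → A ⟶ B → Set u
  Is-∘ {C = C} k g f = ∀ a → Algebra._≈_ C (⟦ hom k ⟧ a) (⟦ hom g ⟧ (⟦ hom f ⟧ a))

  _[1/_]ᴬ : (A : Algebra) → Algebra.Carrier A → Algebra
  A [1/ f ]ᴬ = record { ring = ring A [1/ f ] ; structure = localize (ring A) f ∘ʰ structure A }

  localizeᴬ : (A : Algebra) (f : Algebra.Carrier A) → A ⟶ (A [1/ f ]ᴬ)
  localizeᴬ A f = record
    { hom = localize (ring A) f ; structure-homo = λ _ → CommutativeRing.refl (ring A [1/ f ]) }

  -- The functor of points of a K-scheme, restricted to affine K-schemes.
  record Space : Set (lsuc (lsuc u)) where
    infixr 5 _▸_
    infix 4 _≃_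
    field
      points : Algebra → Setoid (lsuc u) u

    Pt : Algebra → Set (lsuc u)
    Pt A = Setoid.Carrier (points A)

    _≃_ : ∀ {A} → Pt A → Pt A → Set u
    _≃_ {A} = Setoid._≈_ (points A)

    field
      _▸_    : ∀ {A B} → A ⟶ B → Pt A → Pt B
      ▸-cong : ∀ {A B} (f : A ⟶ B) {x y} → x ≃ y → f ▸ x ≃ f ▸ y
      ▸-id   : ∀ {A} (f : A ⟶ A) → Is-id f → ∀ x → f ▸ x ≃ x
      ▸-∘    : ∀ {A B C} (k : A ⟶ C) (g : B ⟶ C) (f : A ⟶ B) → Is-∘ k g f → ∀ x → k ▸ x ≃ g ▸ f ▸ x

    module _ {A : Algebra} where
      open Setoid (points A) public using () renaming (refl to ≃-refl; sym to ≃-sym; trans to ≃-trans)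

  record _⇒_ (X Y : Space) : Set (lsuc u) where
    private
      module X = Space X
      module Y = Space Y
    field
      map     : ∀ {A} → X.Pt A → Y.Pt A
      cong    : ∀ {A} {x y : X.Pt A} → x X.≃ y → map x Y.≃ map y
      natural : ∀ {A B} (f : A ⟶ B) (x : X.Pt A) → f Y.▸ map x Y.≃ map (f X.▸ x)

  -- An 𝒪-module: an A-module for every A-point, with restriction maps along base change.
  record 𝒪-Module (X : Space) : Set (lsuc u) where
    open Space X
    field
      Fib : ∀ {A} → Pt A → Mod (ring A)
      ρ   : ∀ {A B} (f : A ⟶ B) {x y} → f ▸ x ≃ y → SemiLinear (hom f) (Fib x) (Fib y)
      ρ-id : ∀ {A} (f : A ⟶ A) {x} (p : f ▸ x ≃ x) → Is-id f →
             ∀ e → Module._≈ᴹ_ (Fib x) (fun (ρ f p) e) e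
      ρ-∘  : ∀ {A B C} (k : A ⟶ C) (g : B ⟶ C) (f : A ⟶ B) {x y z}
             (r : k ▸ x ≃ z) (q : g ▸ y ≃ z) (p : f ▸ x ≃ y) → Is-∘ k g f →
             ∀ e → Module._≈ᴹ_ (Fib z) (fun (ρ k r) e) (fun (ρ g q) (fun (ρ f p) e))

  -- A finite dual basis compatible with restriction presents the 𝒪-module over Spec A as a
  -- natural direct summand of a free one: the fibre at x is finitely generated projective, and
  -- every fibre over x is its base change.
  record DualBasis {X : Space} (E : 𝒪-Module X) {A : Algebra} (x : Space.Pt X A) : Set (lsuc u) where
    open Space X
    open 𝒪-Module E
    field
      {size}  : ℕ
      gen     : Fin size → ∣ Fib x ∣ᴹ
      coord   : ∀ {B} (f : A ⟶ B) {y} → f ▸ x ≃ y → Fin size → Linear (Fib y) (unitᴹ (ring B))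
      natural : ∀ {B C} (k : A ⟶ C) (g : B ⟶ C) (f : A ⟶ B) {y z}
                (r : k ▸ x ≃ z) (q : g ▸ y ≃ z) (p : f ▸ x ≃ y) → Is-∘ k g f →
                ∀ b e → Algebra._≈_ C (fun (coord k r b) (fun (ρ g q) e)) (⟦ hom g ⟧ (fun (coord f p b) e))
      expand  : ∀ {B} (f : A ⟶ B) {y} (p : f ▸ x ≃ y) e →
                Module._≈ᴹ_ (Fib y) e (lincomb (Fib y) (λ b → fun (coord f p b) e) (λ b → fun (ρ f p) (gen b)))

  LocallyFree : {X : Space} → 𝒪-Module X → ℕ → Set (lsuc u)
  LocallyFree {X} E r = ∀ {A} (x : Pt A) → ∃[ m ] Σ[ f ∈ Vector (Algebra.Carrier A) m ]
    UnitIdeal (ring A) f × (∀ j → Basis (Fib (localizeᴬ A (f j) ▸ x)) r)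
    where
    open Space X
    open 𝒪-Module E

  record VectorBundle (X : Space) (r : ℕ) : Set (lsuc u) where
    open Space X
    field
      𝒪-module : 𝒪-Module X
    open 𝒪-Module 𝒪-module public
    field
      dualBasis   : ∀ {A} (x : Pt A) → DualBasis 𝒪-module x
      locallyFree : LocallyFree 𝒪-module r

    ρ-basis : ∀ {A B} (f : A ⟶ B) {x y} (p : f ▸ x ≃ y) → ∀ {s} → Basis (Fib x) s → Basis (Fib y) s
    ρ-basis {A} {B} f {x} {y} p (e , basis) = fun (ρ f p) ∘ e ,
      pushBasis (ρ f p) gen (coord idᴬ id▸) (coord f p)
        (λ v → Module.≈ᴹ-trans (Fib x) (expand idᴬ id▸ v)
          (lincomb-cong (Fib x) (λ _ → CommutativeRing.refl (ring A)) (λ b → ρ-id idᴬ id▸ (λ _ → CommutativeRing.refl (ring A)) (gen b))))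
        (expand f p)
        (natural f f idᴬ p p id▸ (λ _ → CommutativeRing.refl (ring B)))
        basis
      where
      open DualBasis (dualBasis x)
      id▸ : idᴬ ▸ x ≃ x
      id▸ = ▸-id idᴬ (λ _ → CommutativeRing.refl (ring A)) x

  record BundleMap {X : Space} {r s : ℕ} (E : VectorBundle X r) (F : VectorBundle X s) : Set (lsuc u) where
    open Space X
    private
      module E = VectorBundle E
      module F = VectorBundle F
    field
      at      : ∀ {A} (x : Pt A) → Linear (E.Fib x) (F.Fib x)
      natural : ∀ {A B} (f : A ⟶ B) {x y} (p : f ▸ x ≃ y) e →
                Module._≈ᴹ_ (F.Fib y) (fun (at y) (fun (E.ρ f p) e)) (fun (F.ρ f p) (fun (at x) e))

  infixr 9 _∘ᴮ_
  _∘ᴮ_ : ∀ {X r s t} {E : VectorBundle X r} {F : VectorBundle X s} {G : VectorBundle X t} →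
         BundleMap F G → BundleMap E F → BundleMap E G
  _∘ᴮ_ {G = G} ψ φ = record
    { at = λ x → record
      { fun = λ e → fun (ψ.at x) (fun (φ.at x) e)
      ; cong = λ p → SemiLinear.cong (ψ.at x) (SemiLinear.cong (φ.at x) p)
      ; +ᴹ-homo = λ d e → Module.≈ᴹ-trans (G.Fib x)
          (SemiLinear.cong (ψ.at x) (SemiLinear.+ᴹ-homo (φ.at x) d e)) (SemiLinear.+ᴹ-homo (ψ.at x) _ _)
      ; *ₗ-homo = λ a e → Module.≈ᴹ-trans (G.Fib x)
          (SemiLinear.cong (ψ.at x) (SemiLinear.*ₗ-homo (φ.at x) a e)) (SemiLinear.*ₗ-homo (ψ.at x) _ _) }
    ; natural = λ f {x} {y} p e → Module.≈ᴹ-trans (G.Fib y)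
        (SemiLinear.cong (ψ.at y) (φ.natural f p e)) (ψ.natural f p (fun (φ.at x) e)) }
    where
    module ψ = BundleMap ψ
    module φ = BundleMap φ
    module G = VectorBundle G

  module _ {X Y : Space} (F : X ⇒ Y) where
    private
      module X = Space X
      module Y = Space Y
    open _⇒_ F using (map; cong)

    over : ∀ {A B} (f : A ⟶ B) {x : X.Pt A} {y : X.Pt B} → f X.▸ x X.≃ y → f Y.▸ map x Y.≃ map y
    over f {x} p = Y.≃-trans (_⇒_.natural F f x) (cong p)

    pullbackᴼ : 𝒪-Module Y → 𝒪-Module X
    pullbackᴼ E = record
      { Fib = λ x → E.Fib (map x)
      ; ρ = λ f p → E.ρ f (over f p)
      ; ρ-id = λ f p → E.ρ-id f (over f p)
      ; ρ-∘ = λ k g f r q p → E.ρ-∘ k g f (over k r) (over g q) (over f p) }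
      where module E = 𝒪-Module E

    module _ {r : ℕ} (E : VectorBundle Y r) where
      private module E = VectorBundle E

      abstract
        pullback-dualBasis : ∀ {A} (x : X.Pt A) → DualBasis (pullbackᴼ E.𝒪-module) x
        pullback-dualBasis x = record
          { gen = gen
          ; coord = λ f p → coord f (over f p)
          ; natural = λ k g f r q p → natural k g f (over k r) (over g q) (over f p)
          ; expand = λ f p → expand f (over f p) }
          where open DualBasis (E.dualBasis (map x))

        pullback-locallyFree : LocallyFree (pullbackᴼ E.𝒪-module) r
        pullback-locallyFree {A} x = let (m , f , cover , bases) = E.locallyFree (map x) in
          m , f , cover , λ j → E.ρ-basis idᴬ
            (Y.≃-trans (Y.▸-id idᴬ (λ _ → CommutativeRing.refl (ring A [1/ f j ])) _)
                       (_⇒_.natural F (localizeᴬ A (f j)) x))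
            (bases j)

      pullback : VectorBundle X r
      pullback = record
        { 𝒪-module = pullbackᴼ E.𝒪-module
        ; dualBasis = pullback-dualBasis
        ; locallyFree = pullback-locallyFree }

  -- A subfunctor; a closed subscheme is determined by the one it defines.
  record Subspace (X : Space) (ℓ : Level) : Set (lsuc u ⊔ˡ lsuc ℓ) where
    open Space X
    field
      holds  : ∀ {A} → Pt A → Set ℓ
      stable : ∀ {A B} (f : A ⟶ B) {x y} → f ▸ x ≃ y → holds x → holds y

  infix 4 _≗ˢ_
  _≗ˢ_ : ∀ {X ℓ ℓ′} → Subspace X ℓ → Subspace X ℓ′ → Set (lsuc u ⊔ˡ ℓ ⊔ˡ ℓ′)
  _≗ˢ_ {X} Y Z = ∀ {A} (x : Space.Pt X A) →
    (Subspace.holds Y x → Subspace.holds Z x) × (Subspace.holds Z x → Subspace.holds Y x)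

  ⋂ : ∀ {X ℓ} {J : Set} → (J → Subspace X ℓ) → Subspace X ℓ
  ⋂ Y = record
    { holds = λ x → ∀ j → Subspace.holds (Y j) x
    ; stable = λ f p h j → Subspace.stable (Y j) f p (h j) }

  det : (A : Ring₀ u) {m : ℕ} → (Fin m → Fin m → ∣ A ∣) → ∣ A ∣
  det A {zero}  M = CommutativeRing.1# A
  det A {suc m} M = sum (λ j → sign j * (M zero j * det A (λ a b → M (suc a) (punchIn j b))))
    where
    open CommutativeRing A hiding (zero)
    open RawMonoidDefs +-rawMonoid using (sum)
    sign : ∀ {n} → Fin n → Carrier
    sign zero    = 1#
    sign (suc j) = - sign j

  Increasing : {m n : ℕ} → (Fin m → Fin n) → Set
  Increasing c = ∀ {i j} → i Fin.< j → c i Fin.< c j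

  module _ {X : Space} {r s : ℕ} {E : VectorBundle X r} {F : VectorBundle X s} (φ : BundleMap E F) where
    open Space X
    private
      module E = VectorBundle E
      module F = VectorBundle F
      module φ = BundleMap φ

    Matrix : ∀ {A} {y : Pt A} → (Fin r → ∣ E.Fib y ∣ᴹ) → (Fin s → ∣ F.Fib y ∣ᴹ) →
             (Fin s → Fin r → Algebra.Carrier A) → Set u
    Matrix {y = y} e g M = ∀ j → Module._≈ᴹ_ (F.Fib y) (fun (φ.at y) (e j)) (lincomb (F.Fib y) (λ i → M i j) g)

    -- The A-points x : Spec A → X at which, after every base change Spec B → Spec A trivializing
    -- E and F, the entries of the matrix of φ pulled back to B satisfy C. Trivializations exist
    -- Zariski locally, so for vanishing conditions on functions of the entries these are the
    -- points of the closed subscheme which those functions cut out locally.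
    Locally : (∀ {A} → (Fin s → Fin r → Algebra.Carrier A) → Set u) → Subspace X (lsuc u)
    Locally C = record
      { holds = λ {A} x → ∀ {B} (f : A ⟶ B) {y} → f ▸ x ≃ y →
          ∀ {e g} → IsBasis (E.Fib y) e → IsBasis (F.Fib y) g → ∀ M → Matrix e g M → C {B} M
      ; stable = λ f {x} p h {C} g q → h (g ∘ᴬ f)
          (≃-trans (▸-∘ (g ∘ᴬ f) g f (λ _ → CommutativeRing.refl (ring C)) x) (≃-trans (▸-cong g p) q)) }
      where
      _∘ᴬ_ : ∀ {A B C} → B ⟶ C → A ⟶ B → A ⟶ C
      _∘ᴬ_ {C = C} g f = record
        { hom = hom g ∘ʰ hom f
        ; structure-homo = λ a → CommutativeRing.trans (ring C)
            (RingHom.⟦⟧-cong (hom g) (structure-homo f a)) (structure-homo g a) }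

    zeroScheme : Subspace X (lsuc u)
    zeroScheme = Locally (λ {A} M → ∀ i j → Algebra._≈_ A (M i j) (Algebra.0# A))

    -- rank φ ≤ t
    degeneracyLocus : ℕ → Subspace X (lsuc u)
    degeneracyLocus t = Locally (λ {A} M →
      ∀ (rows : Fin (suc t) → Fin s) (cols : Fin (suc t) → Fin r) → Increasing rows → Increasing cols →
      Algebra._≈_ A (det (ring A) (λ a b → M (rows a) (cols b))) (Algebra.0# A))

  record DegeneracyData (X : Space) : Set (lsuc (lsuc u)) where
    field
      {r s} : ℕ
      E     : VectorBundle X r
      F     : VectorBundle X s
      φ     : BundleMap E F
      rank  : ℕ

  -- a finite intersection of degeneracy loci of maps of vector bundles
  Determinantal : ∀ {X ℓ} → Subspace X ℓ → Set (lsuc (lsuc u) ⊔ˡ ℓ)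
  Determinantal {X} Z = ∃[ m ] Σ[ D ∈ (Fin m → DegeneracyData X) ]
    (Z ≗ˢ ⋂ (λ j → let open DegeneracyData (D j) in degeneracyLocus φ rank))

  module _ (X : Space) (N : ℕ) where
    Trivialᴼ : 𝒪-Module X
    Trivialᴼ = record
      { Fib = λ {A} _ → Free (ring A) N
      ; ρ = λ f _ → freeMap (hom f)
      ; ρ-id = λ _ _ f-id e β → f-id (e β)
      ; ρ-∘ = λ _ _ _ _ _ _ k-gf e β → k-gf (e β) }

    abstract
      Trivial-dualBasis : ∀ {A} (x : Space.Pt X A) → DualBasis Trivialᴼ x
      Trivial-dualBasis {A} x = record
        { gen = δ (ring A)
        ; coord = λ _ _ → coordinate
        ; natural = λ {_} {C} _ _ _ _ _ _ _ _ _ → CommutativeRing.refl (ring C)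
        ; expand = λ {B} f _ e → Module.≈ᴹ-trans (Free (ring B) N)
            (Module.≈ᴹ-sym (Free (ring B) N) (free-expand (ring B) e))
            (lincomb-cong (Free (ring B) N) (λ _ → CommutativeRing.refl (ring B))
              (λ β γ → CommutativeRing.sym (ring B) (hom-δ (hom f) β γ))) }

      Trivial-locallyFree : LocallyFree Trivialᴼ N
      Trivial-locallyFree {A} x =
        1 , (λ _ → CommutativeRing.1# (ring A)) , unitIdeal-1 (ring A) , λ _ → standardBasis

    Trivial : VectorBundle X N
    Trivial = record
      { 𝒪-module = Trivialᴼ ; dualBasis = Trivial-dualBasis ; locallyFree = Trivial-locallyFree }

  Gr : (r N : ℕ) → Space
  Gr r N = record
    { points = λ A → record
      { Carrier = Summand r N (ring A)
      ; _≈_ = λ x y → L x ≐ L y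
      ; isEquivalence = record
        { refl = id , id
        ; sym = λ (p , q) → q , p
        ; trans = λ (p , q) (p′ , q′) → p′ ∘ p , q ∘ q′ } }
    ; _▸_ = λ f → pushSummand (hom f)
    ; ▸-cong = λ f (p , q) → Image-mono (hom f) p , Image-mono (hom f) q
    ; ▸-id = λ f f-id x → baseChange-id (hom f) f-id (L x)
    ; ▸-∘ = λ k g f k-gf x → baseChange-∘ (hom k) (hom g) (hom f) k-gf (L x) }
    where open Summand

  module _ {r N : ℕ} where
    open Space (Gr r N)
    open Summand

    private
      maps : ∀ {A B} (f : A ⟶ B) {x : Pt A} {y : Pt B} → _≃_ {B} (f ▸ x) y →
             ∀ {v} → v ∈ L x → (⟦ hom f ⟧ ∘ v) ∈ L y
      maps f (p , _) v∈ = p (image v∈)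

      R : ∀ {A B} (f : A ⟶ B) {x : Pt A} {y : Pt B} → _≃_ {B} (f ▸ x) y → Retraction (L y)
      R f {x} p = retraction-resp {L = baseChange (hom f) (L x)} p (baseChangeRetraction (hom f) (retraction x))

    tautologicalᴼ : 𝒪-Module (Gr r N)
    tautologicalᴼ = record
      { Fib = λ x → ⟨ L x ⟩
      ; ρ = λ f {x} {y} p → subMap (hom f) (L x) (L y) (maps f {x} {y} p)
      ; ρ-id = λ f p f-id e β → f-id (proj₁ e β)
      ; ρ-∘ = λ k g f r q p k-gf e β → k-gf (proj₁ e β) }

    quotientᴼ : 𝒪-Module (Gr r N)
    quotientᴼ = record
      { Fib = λ x → Quotient (L x)
      ; ρ = λ f {x} {y} p → quotientMap (hom f) (L x) (L y) (maps f {x} {y} p)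
      ; ρ-id = λ f {x} p f-id e → SemiLinear.cong (projection (L x)) (λ β → f-id (e β))
      ; ρ-∘ = λ k g f {z = z} r q p k-gf e → SemiLinear.cong (projection (L z)) (λ β → k-gf (e β)) }

    abstract
      tautological-dualBasis : ∀ {A} (x : Pt A) → DualBasis tautologicalᴼ {A} x
      tautological-dualBasis {A} x = record
        { gen = λ β → Retraction.column (retraction x) β , Retraction.column∈ (retraction x) β
        ; coord = λ f {y} p → restrictCoordinate (L y) (R f {x} {y} p)
        ; natural = λ {_} {C} _ _ _ _ _ _ _ _ _ → CommutativeRing.refl (ring C)
        ; expand = λ f {y} p e → sub-expand (L y) (R f {x} {y} p) e }

      quotient-dualBasis : ∀ {A} (x : Pt A) → DualBasis quotientᴼ {A} x
      quotient-dualBasis {A} x = record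
        { gen = δ (ring A)
        ; coord = λ f {y} p → cokernelCoordinate (L y) (R f {x} {y} p)
        ; natural = λ k g f {y} {z} r q p k-gf → cokernelCoordinate-natural (hom g) (L y) (L z)
            (maps g {y} {z} q) (R f {x} {y} p) (R k {x} {z} r)
            (λ β γ → k-gf (Retraction.column (retraction x) β γ))
        ; expand = λ {B} f {y} p e → quotientMap-expand (hom f) (L x) (L y) (maps f {x} {y} p)
            (retraction x) (R f {x} {y} p) (λ _ _ → CommutativeRing.refl (ring B)) e }

      tautological-locallyFree : LocallyFree tautologicalᴼ r
      tautological-locallyFree x = _ , opens x , cover x , free x

      quotient-locallyFree : LocallyFree quotientᴼ (N ∸ r)
      quotient-locallyFree x = _ , opens x , cover x , cofree x

    tautological : VectorBundle (Gr r N) r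
    tautological = record
      { 𝒪-module = tautologicalᴼ
      ; dualBasis = λ {A} → tautological-dualBasis {A}
      ; locallyFree = λ {A} → tautological-locallyFree {A} }

    quotient : VectorBundle (Gr r N) (N ∸ r)
    quotient = record
      { 𝒪-module = quotientᴼ
      ; dualBasis = λ {A} → quotient-dualBasis {A}
      ; locallyFree = λ {A} → quotient-locallyFree {A} }

  module _ {X : Space} {r N : ℕ} (F : X ⇒ Gr r N) where
    private
      L : ∀ {A} → Space.Pt X A → Submodule (ring A) N
      L {A} x = Summand.L (_⇒_.map F {A} x)

    include : BundleMap (pullback F tautological) (Trivial X N)
    include = record
      { at = λ {A} x → inclusion (L {A} x)
      ; natural = λ {A} {B} f p e β → CommutativeRing.refl (ring B) }

    project : BundleMap (Trivial X N) (pullback F quotient)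
    project = record
      { at = λ {A} x → projection (L {A} x)
      ; natural = λ {A} {B} f {x} {y} p e → Module.≈ᴹ-refl (Quotient (L {B} y)) {⟦ hom f ⟧ ∘ e} }

  -- The base change of the K-linear map Kᴺ → Kᴹ sending the a-th basis vector to col a.
  constant : (X : Space) {N M : ℕ} (col : Fin N → Vector (CommutativeRing.Carrier K) M) →
             BundleMap (Trivial X N) (Trivial X M)
  constant X {N} {M} col = record
    { at = λ {A} x → let open Module (Free (ring A) M) in record
      { fun = λ v → lincomb (Free (ring A) M) v (colᴬ A)
      ; cong = λ p → lincomb-cong (Free (ring A) M) p (λ a → ≈ᴹ-refl {colᴬ A a})
      ; +ᴹ-homo = λ v w → lincomb-+ (Free (ring A) M) v w (colᴬ A)
      ; *ₗ-homo = λ a v → lincomb-* (Free (ring A) M) a v (colᴬ A) }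
    ; natural = λ {A} {B} f p v → let open Module (Free (ring B) M) in ≈ᴹ-sym (≈ᴹ-trans
        (fun-lincomb (freeMap (hom f)) v (colᴬ A))
        (lincomb-cong (Free (ring B) M) (λ _ → CommutativeRing.refl (ring B)) (λ a b → structure-homo f (col a b)))) }
    where
    colᴬ : (A : Algebra) → Fin N → Vector (Algebra.Carrier A) M
    colᴬ A a b = ⟦ structure A ⟧ (col a b)

  zeroPoint : (r N : ℕ) → r ≡ 0 → ∀ {A} → Space.Pt (Gr r N) A
  zeroPoint .0 N ≡.refl {A} = zeroSummand (ring A) N

  zeroMap : (X : Space) (r N : ℕ) → r ≡ 0 → X ⇒ Gr r N
  zeroMap X .0 N ≡.refl = record
    { map = λ {A} _ → zeroPoint 0 N ≡.refl {A}
    ; cong = λ _ → id , id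
    ; natural = λ {A} {B} f _ → baseChange-zero (hom f) , λ p → resp (≈ᴹ-sym {B} p) zeroᴵ }
    where
    ≈ᴹ-sym : ∀ {B : Algebra} {v w : Vector (Algebra.Carrier B) N} →
             (∀ β → Algebra._≈_ B (v β) (w β)) → ∀ β → Algebra._≈_ B (w β) (v β)
    ≈ᴹ-sym {B} p β = CommutativeRing.sym (ring B) (p β)

module Incidence {u : Level} (K : CommutativeRing u u) {k : ℕ} (s : Vector ℕ (suc k)) (R′ : ℕ → ℕ) where
  open Geometry K
  open Format s using (n)

  S : ℕ → ℕ
  S p = dimC n p

  K′ : ℕ → ℕ
  K′ p = S p ∸ R′ p

  -- The factors are indexed by the p ≤ n with K′ p > 0.
  Gr[s] : Space
  Gr[s] = record
    { points = λ A → record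
      { Carrier = (p : ℕ) → .(p ℕ.≤ n) → .(0 ℕ.< K′ p) → Space.Pt (Gr (K′ p) (S p)) A
      ; _≈_ = λ x y → (p : ℕ) .(p≤n : p ℕ.≤ n) .(pos : 0 ℕ.< K′ p) →
                Space._≃_ (Gr (K′ p) (S p)) {A} (x p p≤n pos) (y p p≤n pos)
      ; isEquivalence = record
        { refl = λ p _ _ → id , id
        ; sym = λ eq p p≤n pos → let (there , back) = eq p p≤n pos in back , there
        ; trans = λ eq eq′ p p≤n pos → let (there , back) = eq p p≤n pos ; (there′ , back′) = eq′ p p≤n pos in
            there′ ∘ there , back ∘ back′ } }
    ; _▸_ = λ f x p p≤n pos → Space._▸_ (Gr (K′ p) (S p)) f (x p p≤n pos)
    ; ▸-cong = λ f {x} {y} eq p p≤n pos →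
        Space.▸-cong (Gr (K′ p) (S p)) f {x p p≤n pos} {y p p≤n pos} (eq p p≤n pos)
    ; ▸-id = λ f f-id x p p≤n pos → Space.▸-id (Gr (K′ p) (S p)) f f-id (x p p≤n pos)
    ; ▸-∘ = λ k g f k-gf x p p≤n pos → Space.▸-∘ (Gr (K′ p) (S p)) k g f k-gf (x p p≤n pos) }

  π : (p : ℕ) → .(p ℕ.≤ n) → .(0 ℕ.< K′ p) → Gr[s] ⇒ Gr (K′ p) (S p)
  π p p≤n pos = record
    { map = λ x → x p p≤n pos
    ; cong = λ eq → eq p p≤n pos
    ; natural = λ f x → id , id }

  -- L_p for every p ≤ n, with L_p = 0 when K′ p = 0
  L̂ : (p : ℕ) → .(p ℕ.≤ n) → Gr[s] ⇒ Gr (K′ p) (S p)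
  L̂ p p≤n = case (0 ℕ.<? K′ p)
    where
    case : Dec (0 ℕ.< K′ p) → Gr[s] ⇒ Gr (K′ p) (S p)
    case (yes pos) = π p p≤n pos
    case (no ¬pos) = zeroMap Gr[s] (K′ p) (S p) (ℕ.n≤0⇒n≡0 (ℕ.≮⇒≥ ¬pos))

  -- the pairs (p , i) with 1 ≤ p ≤ n and K′ p > 0; here p = suc q
  record FacePair : Set where
    field
      q   : ℕ
      q<n : q ℕ.< n
      pos : 0 ℕ.< K′ (suc q)
      i   : Fin (suc (suc q))

  module _ (d : FacePair) where
    open FacePair d

    source : Gr[s] ⇒ Gr (K′ (suc q)) (S (suc q))
    source = π (suc q) q<n pos

    target : Gr[s] ⇒ Gr (K′ q) (S q)
    target = L̂ q (ℕ.<⇒≤ q<n)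

    𝒮 : VectorBundle Gr[s] (K′ (suc q))
    𝒮 = pullback source tautological

    𝒬 : VectorBundle Gr[s] (S q ∸ K′ q)
    𝒬 = pullback target quotient

    dᵢ : BundleMap (Trivial Gr[s] (S (suc q))) (Trivial Gr[s] (S q))
    dᵢ = constant Gr[s] (face K n q i)

    φ : BundleMap 𝒮 𝒬
    φ = project target ∘ᴮ dᵢ ∘ᴮ include source

    incidence : Subspace Gr[s] u
    incidence = record
      { holds = λ {A} x → ∀ {v} → v ∈ L source {A} x → fun (BundleMap.at dᵢ {A} x) v ∈ L target {A} x
      ; stable = λ {A} {B} f {x} {y} p inc v∈ →
          Image-least (hom f)
            (preimage (BundleMap.at dᵢ {B} y) (L target {B} y))
            (λ {v} v∈ → Submodule.resp (L target {B} y)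
              (Module.≈ᴹ-sym (Free (Algebra.ring B) (S q)) (BundleMap.natural dᵢ f {x} {y} p v))
              (proj₁ (over target f {x} {y} p) (image (inc v∈))))
            (proj₂ (over source f {x} {y} p) v∈) }
      where
      L : ∀ {r N} → Gr[s] ⇒ Gr r N → ∀ {A} → Space.Pt Gr[s] A → Submodule (Algebra.ring A) N
      L F {A} x = Summand.L (_⇒_.map F {A} x)

  Gr-simp : Subspace Gr[s] u
  Gr-simp = ⋂ incidence

{-# OPTIONS --safe #-}

-- For a single bundle map φ, all three conditions at an A-point x say that the fibre map φ.at x is
-- zero. If it is, then so are its base changes, since every fibre over x is spanned by restrictions
-- of elements of the fibre at x. Conversely, bundles are trivial Zariski locally, vanishing matrix
-- entries make φ vanish over the trivializing opens, and an element of a fibre which restricts to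
-- zero on an open cover is zero, as its dual basis coordinates are. For the map φ_{p,i} into the
-- quotient bundle, φ.at x = 0 says precisely that d_i(L_p) ⊆ L_{p-1}.
module Submission where

open import Level using (Level)
open import Algebra.Apartness.Bundles using (HeytingField; HeytingCommutativeRing)
open import Algebra.Bundles using (CommutativeRing)
open import Algebra.Module.Bundles using (Module)
import Algebra.Properties.AbelianGroup as AbelianGroupProps
import Algebra.Properties.Semiring.Exp as Exp
import Algebra.Properties.Semiring.Sum as Sum
open import Data.Empty using (⊥-elim)
open import Data.Fin.Base using (Fin; zero; suc; toℕ; fromℕ<)
open import Data.Fin.Properties using (toℕ<n; toℕ-fromℕ<)
open import Data.List.Base using (List; []; map; concatMap; allFin; length; lookup)
import Data.List.Membership.Propositional as List using (_∈_)
open import Data.List.Membership.Propositional.Properties using (∈-map⁺; ∈-concatMap⁺; ∈-allFin)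
open import Data.List.Relation.Unary.Any using (index)
import Data.List.Relation.Unary.Any as Any
open import Data.List.Relation.Unary.Any.Properties using (lookup-index)
open import Data.Nat.Base using (ℕ; zero; suc; _≤_; _<_)
import Data.Nat.Properties as ℕ
open import Data.Product.Base using (_×_; _,_; proj₁; proj₂; map₂)
open import Data.Vec.Functional using (Vector)
open import Function.Base using (_∘_)
open import Relation.Binary.PropositionalEquality as ≡ using (_≡_)
import Relation.Binary.Reasoning.Setoid as SetoidReasoning
open import Relation.Nullary.Decidable using (Dec; yes; no)
open import Defs

open RingHom using (⟦_⟧)
open SemiLinear using (fun)

-- Ring elements that vanish on an open cover.

module _ {u : Level} (A : Ring₀ u) where
  open CommutativeRing A hiding (zero)
  open Exp semiring using (_^_)
  open Sum semiring using (sum; *-distribʳ-sum; sum-cong-≋; sum-replicate-zero)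
  open SetoidReasoning setoid

  -- Multiply a relation expressing 1 in terms of the `f j` by `c`.
  unitIdeal-faithful : ∀ {m} {f : Vector Carrier m} → UnitIdeal A f →
    ∀ c → (∀ j → f j * c ≈ 0#) → c ≈ 0#
  unitIdeal-faithful {m} {f} (a , p) c fc≈0 = begin
    c                             ≈⟨ *-identityˡ c ⟨
    1# * c                        ≈⟨ *-congʳ p ⟨
    sum (λ j → a j * f j) * c     ≈⟨ *-distribʳ-sum c (λ j → a j * f j) ⟩
    sum (λ j → (a j * f j) * c)   ≈⟨ sum-cong-≋ (λ j → trans (*-assoc _ _ _) (trans (*-congˡ (fc≈0 j)) (zeroʳ (a j)))) ⟩
    sum {m} (λ _ → 0#)            ≈⟨ sum-replicate-zero m ⟩
    0# ∎

  -- The factors are removed one at a time: f₀ c = 0 by induction on the exponent of f₀, and then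
  -- c lies in the smaller class of those elements of P which f₀ kills.
  powers-faithful : ∀ {m} (f : Vector Carrier m) (P : Carrier → Set u) →
    (∀ a {c} → P c → P (a * c)) →
    (∀ c → P c → (∀ j → f j * c ≈ 0#) → c ≈ 0#) →
    ∀ (k : Fin m → ℕ) c → P c → (∀ j → f j ^ k j * c ≈ 0#) → c ≈ 0#
  powers-faithful {zero}  f P P-* faithful k c c∈ _ = faithful c c∈ (λ ())
  powers-faithful {suc m} f P P-* faithful k c c∈ vanish =
    descend (k zero) c c∈ (vanish zero) (vanish ∘ suc)
    where
    f₀ : Carrier
    f₀ = f zero

    swap : ∀ a b {c} → a * c ≈ 0# → a * (b * c) ≈ 0#
    swap a b {c} ac≈0 = begin
      a * (b * c) ≈⟨ *-assoc a b c ⟨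
      (a * b) * c ≈⟨ *-congʳ (*-comm a b) ⟩
      (b * a) * c ≈⟨ *-assoc b a c ⟩
      b * (a * c) ≈⟨ *-congˡ ac≈0 ⟩
      b * 0#      ≈⟨ zeroʳ b ⟩
      0# ∎

    descend : ∀ l c → P c → f₀ ^ l * c ≈ 0# → (∀ j → f (suc j) ^ k (suc j) * c ≈ 0#) → c ≈ 0#
    descend zero    c c∈ p q = trans (sym (*-identityˡ c)) p
    descend (suc l) c c∈ p q = powers-faithful (f ∘ suc) (λ d → P d × f₀ * d ≈ 0#)
      (λ a (d∈ , r) → P-* a d∈ , swap f₀ a r)
      -- `faithful` also asks that `f₀` kill `d`; membership in the smaller class supplies this.
      (λ d (d∈ , r) s → faithful d d∈ λ { zero → r ; (suc j) → s j })
      (k ∘ suc) c (c∈ , f₀c≈0) q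
      where
      f₀c≈0 : f₀ * c ≈ 0#
      f₀c≈0 = descend l (f₀ * c) (P-* f₀ c∈)
        (begin
          f₀ ^ l * (f₀ * c) ≈⟨ *-assoc _ f₀ c ⟨
          (f₀ ^ l * f₀) * c ≈⟨ *-congʳ (*-comm _ f₀) ⟩
          (f₀ * f₀ ^ l) * c ≈⟨ p ⟩
          0# ∎)
        (λ j → swap _ f₀ (q j))

  -- An element dying in `A [1/ f j ]` is killed by a power of `f j`, with an exponent depending on
  -- `j`. The class `P` starts as the whole ring, encoded as `d ≈ d`.
  locally-zero : ∀ {m} {f : Vector Carrier m} → UnitIdeal A f → ∀ {c} →
    (∀ j → CommutativeRing._≈_ (A [1/ f j ]) (⟦ localize A (f j) ⟧ c) (CommutativeRing.0# (A [1/ f j ]))) →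
    c ≈ 0#
  locally-zero {f = f} cover {c} c≈0 = powers-faithful f (λ d → d ≈ d) (λ _ _ → refl)
    (λ d _ → unitIdeal-faithful cover d) (proj₁ ∘ killed) c refl (proj₂ ∘ killed)
    where
    killed : ∀ j → _
    killed j = map₂ (λ p → trans p (zeroʳ _)) (localize-kernel A (f j) {c} {0#}
      (CommutativeRing.trans (A [1/ f j ]) (c≈0 j)
        (CommutativeRing.sym (A [1/ f j ]) (RingHom.0#-homo (localize A (f j))))))

-- Linear combinations and linear maps that vanish.

module _ {u : Level} {A : Ring₀ u} (M : Mod A) where
  open Module M

  lincomb-zeroˡ : ∀ {r} {c : Vector ∣ A ∣ r} {e} →
    (∀ i → CommutativeRing._≈_ A (c i) (CommutativeRing.0# A)) → lincomb M c e ≈ᴹ 0ᴹ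
  lincomb-zeroˡ {e = e} c≈0 = ≈ᴹ-trans (lincomb-cong M c≈0 (λ _ → ≈ᴹ-refl)) (lincomb-zero M e)

  lincomb-zeroʳ : ∀ {r} {c : Vector ∣ A ∣ r} {e} → (∀ i → e i ≈ᴹ 0ᴹ) → lincomb M c e ≈ᴹ 0ᴹ
  lincomb-zeroʳ {zero}  e≈0 = ≈ᴹ-refl
  lincomb-zeroʳ {suc r} e≈0 = ≈ᴹ-trans
    (+ᴹ-cong (≈ᴹ-trans (*ₗ-congˡ (e≈0 zero)) (*ₗ-zeroʳ _)) (lincomb-zeroʳ (e≈0 ∘ suc)))
    (+ᴹ-identityˡ 0ᴹ)

module _ {u : Level} {A : Ring₀ u} {M N : Mod A} (φ : Linear M N) where
  private
    module M = Module M
    module N = Module N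

  zero-on-generators : ∀ {r} {e : Fin r → ∣ M ∣ᴹ} → (∀ j → fun φ (e j) N.≈ᴹ N.0ᴹ) →
    ∀ {x c} → x M.≈ᴹ lincomb M c e → fun φ x N.≈ᴹ N.0ᴹ
  zero-on-generators {e = e} φe≈0 {x} {c} p =
    N.≈ᴹ-trans (SemiLinear.cong φ p) (N.≈ᴹ-trans (fun-lincomb φ c e) (lincomb-zeroʳ N φe≈0))

-- Vanishing of a bundle map at a point and its zero scheme.

module _ {u : Level} (K : CommutativeRing u u) where
  open Geometry K
  open Algebra using (ring)

  infixr 9 _∘ᴬ_
  _∘ᴬ_ : ∀ {A B C} → B ⟶ C → A ⟶ B → A ⟶ C
  _∘ᴬ_ {C = C} g f = record
    { hom = hom g ∘ʰ hom f
    ; structure-homo = λ a → CommutativeRing.trans (ring C)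
        (RingHom.⟦⟧-cong (hom g) (structure-homo f a)) (structure-homo g a) }

  module _ {X : Space} {r : ℕ} (E : VectorBundle X r) where
    open Space X
    open VectorBundle E

    id▸ : ∀ {A} (x : Pt A) → idᴬ ▸ x ≃ x
    id▸ {A} x = ▸-id idᴬ (λ _ → CommutativeRing.refl (ring A)) x

    bundle-locally-zero : ∀ {A} {x : Pt A} {m} {f : Vector (Algebra.Carrier A) m} → UnitIdeal (ring A) f →
      ∀ v → (∀ j → let y = localizeᴬ A (f j) ▸ x in
        Module._≈ᴹ_ (Fib y) (fun (ρ (localizeᴬ A (f j)) (≃-refl {x = y})) v) (Module.0ᴹ (Fib y))) →
      Module._≈ᴹ_ (Fib x) v (Module.0ᴹ (Fib x))
    bundle-locally-zero {A} {x} {f = f} cover v v≈0 =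
      Module.≈ᴹ-trans (Fib x) (expand idᴬ (id▸ x) v) (lincomb-zeroˡ (Fib x) (λ b →
        locally-zero (ring A) cover (λ j → coord≈0 b j)))
      where
      open DualBasis (dualBasis x)
      coord≈0 : ∀ b j → Algebra._≈_ (A [1/ f j ]ᴬ)
        (⟦ localize (ring A) (f j) ⟧ (fun (coord idᴬ (id▸ x) b) v)) (Algebra.0# (A [1/ f j ]ᴬ))
      coord≈0 b j = B.trans
        -- Factoring `ℓ` as `ℓ` after `idᴬ`, the localized coordinate of `v` is the coordinate of
        -- its restriction.
        (B.sym (natural ℓ ℓ idᴬ ≃-refl ≃-refl (id▸ x) (λ _ → B.refl) b v))
        (B.trans (SemiLinear.cong (coord ℓ ≃-refl b) (v≈0 j)) (SemiLinear.0ᴹ-homo (coord ℓ ≃-refl b)))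
        where
        ℓ = localizeᴬ A (f j)
        module B = CommutativeRing (ring (A [1/ f j ]ᴬ))

  module _ {X : Space} {r s : ℕ} {E : VectorBundle X r} {F : VectorBundle X s} (φ : BundleMap E F) where
    open Space X
    private
      module E = VectorBundle E
      module F = VectorBundle F
      module φ = BundleMap φ

    Vanishes : ∀ {A} → Pt A → Set u
    Vanishes x = ∀ e → Module._≈ᴹ_ (F.Fib x) (fun (φ.at x) e) (Module.0ᴹ (F.Fib x))

    vanishes-pull : ∀ {A B} (f : A ⟶ B) {x y} → f ▸ x ≃ y → Vanishes x → Vanishes y
    vanishes-pull f {x} {y} p φx≈0 e = zero-on-generators (φ.at y)
      (λ b → Fy.≈ᴹ-trans (φ.natural f p (gen b))
        (Fy.≈ᴹ-trans (SemiLinear.cong (F.ρ f p) (φx≈0 (gen b))) (SemiLinear.0ᴹ-homo (F.ρ f p))))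
      (expand f p e)
      where
      open DualBasis (E.dualBasis x)
      module Fy = Module (F.Fib y)

    vanishes-cover : ∀ {A} {x : Pt A} {m} {f : Vector (Algebra.Carrier A) m} → UnitIdeal (ring A) f →
      (∀ j → Vanishes (localizeᴬ A (f j) ▸ x)) → Vanishes x
    vanishes-cover {A} {x} {f = f} cover h e = bundle-locally-zero F cover (fun (φ.at x) e) (λ j →
      let ℓ = localizeᴬ A (f j)
          module Fℓ = Module (F.Fib (ℓ ▸ x))
      in Fℓ.≈ᴹ-trans (Fℓ.≈ᴹ-sym (φ.natural ℓ ≃-refl e)) (h j (fun (E.ρ ℓ ≃-refl) e)))

    -- Column `j` holds the coordinates of the image of `e j` in the basis `g`; that image is zero,
    -- so independence applies.
    vanishes⇒zeroScheme : ∀ {A} (x : Pt A) → Vanishes x → Subspace.holds (zeroScheme φ) x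
    vanishes⇒zeroScheme x φx≈0 f {y} p {e} e-basis g-basis M matrix i j =
      IsBasis.independent g-basis (λ i → M i j)
        (Fy.≈ᴹ-trans (Fy.≈ᴹ-sym (matrix j)) (vanishes-pull f p φx≈0 (e j))) i
      where module Fy = Module (F.Fib y)

    -- `E` and `F` come with different trivializing covers, so `F` is trivialized over each open set
    -- of the cover for `E`, and the basis of `E` is restricted further.
    zeroScheme⇒vanishes : ∀ {A} (x : Pt A) → Subspace.holds (zeroScheme φ) x → Vanishes x
    zeroScheme⇒vanishes {A} x h =
      let (_ , f , cover , E-basis) = E.locallyFree x in
      vanishes-cover cover λ j →
        let ℓ = localizeᴬ A (f j)
            (_ , f′ , cover′ , F-basis) = F.locallyFree (ℓ ▸ x)
        in vanishes-cover cover′ λ j′ →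
          let ℓ′ = localizeᴬ (A [1/ f j ]ᴬ) (f′ j′)
              (e , e-basis) = E.ρ-basis ℓ′ ≃-refl (E-basis j)
              (g , g-basis) = F-basis j′
              z = ℓ′ ▸ ℓ ▸ x
              coefficients = λ b → IsBasis.generating g-basis (fun (φ.at z) (e b))
              -- The zero scheme tests a single base change of `x`, so the two localizations are
              -- composed and the result is identified with `z`.
              entries≈0 = h (ℓ′ ∘ᴬ ℓ)
                (▸-∘ (ℓ′ ∘ᴬ ℓ) ℓ′ ℓ (λ _ → CommutativeRing.refl (ring (A [1/ f j ]ᴬ [1/ f′ j′ ]ᴬ))) x)
                e-basis g-basis (λ a b → proj₁ (coefficients b) a) (λ b → proj₂ (coefficients b))
          in λ v → zero-on-generators (φ.at z)
            (λ b → Module.≈ᴹ-trans (F.Fib z) (proj₂ (coefficients b))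
              (lincomb-zeroˡ (F.Fib z) (λ a → entries≈0 a b)))
            (proj₂ (IsBasis.generating e-basis v))

    -- Rank zero degeneracy loci.

    private
      det₁ : (A : Ring₀ u) (M : Fin 1 → Fin 1 → ∣ A ∣) → CommutativeRing._≈_ A (det A M) (M zero zero)
      det₁ A M = trans (+-identityʳ _) (trans (*-identityˡ _) (*-identityʳ _))
        where open CommutativeRing A

    zeroScheme⇒degeneracyLocus : ∀ {A} (x : Pt A) →
      Subspace.holds (zeroScheme φ) x → Subspace.holds (degeneracyLocus φ 0) x
    zeroScheme⇒degeneracyLocus x h {B} f p e-basis g-basis M matrix rows cols _ _ =
      CommutativeRing.trans (ring B) (det₁ (ring B) (λ a b → M (rows a) (cols b)))
        (h f p e-basis g-basis M matrix (rows zero) (cols zero))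

    degeneracyLocus⇒zeroScheme : ∀ {A} (x : Pt A) →
      Subspace.holds (degeneracyLocus φ 0) x → Subspace.holds (zeroScheme φ) x
    degeneracyLocus⇒zeroScheme x h {B} f p e-basis g-basis M matrix i j =
      CommutativeRing.trans (ring B) (CommutativeRing.sym (ring B) (det₁ (ring B) (λ _ _ → M i j)))
        (h f p e-basis g-basis M matrix (λ _ → i) (λ _ → j)
          -- A choice of a single row or column is vacuously increasing.
          (λ { {zero} {zero} () }) (λ { {zero} {zero} () }))

  -- Reindexes by positions in the list; repeated entries would not change the intersection.
  determinantal : ∀ {X ℓ} {J : Set} (D : J → DegeneracyData X) (js : List J) → (∀ j → j List.∈ js) →
    (Z : Subspace X ℓ) →
    (Z ≗ˢ ⋂ (λ j → let open DegeneracyData (D j) in degeneracyLocus φ rank)) → Determinantal Z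
  determinantal {X} {J = J} D js complete Z Z≗⋂ = length js , (λ i → D (lookup js i)) , λ {A} x →
    (λ z i → proj₁ (Z≗⋂ {A} x) z (lookup js i)) ,
    (λ h → proj₂ (Z≗⋂ {A} x) (λ j →
      ≡.subst (λ j → Subspace.holds (locus j) {A} x) (≡.sym (lookup-index (complete j))) (h (index (complete j)))))
    where
    locus : J → Subspace X _
    locus j = degeneracyLocus φ rank
      where open DegeneracyData (D j)

-- Enumeration of the face pairs.

module _ {u : Level} (K : CommutativeRing u u) {k : ℕ} (s : Vector ℕ (suc k)) (R′ : ℕ → ℕ) where
  open Geometry K
  open Incidence K s R′
  open Format s using (n)

  facePairsAt : ∀ q → q < n → Dec (0 < K′ (suc q)) → List FacePair
  -- Here p is `suc q`, and a p-simplex has p + 1 faces.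
  facePairsAt q q<n (yes pos) = map (λ i → record { q = q ; q<n = q<n ; pos = pos ; i = i }) (allFin (suc (suc q)))
  facePairsAt q q<n (no _)    = []

  facePairsOver : Fin n → List FacePair
  facePairsOver q = facePairsAt (toℕ q) (toℕ<n q) (0 ℕ.<? K′ (suc (toℕ q)))

  facePairs : List FacePair
  facePairs = concatMap facePairsOver (allFin n)

  facePairsAt-complete : ∀ d q<n pos? → d List.∈ facePairsAt (FacePair.q d) q<n pos?
  facePairsAt-complete d q<n (no ¬pos)  = ⊥-elim (¬pos (FacePair.pos d))
  facePairsAt-complete d q<n (yes pos) = ≡.subst (List._∈ facePairsAt (FacePair.q d) q<n (yes pos))
    -- The listed pair may differ from `d` in its two inequality proofs, which are irrelevant.
    (≡.cong₂ (λ q<n pos → record { q = FacePair.q d ; q<n = q<n ; pos = pos ; i = FacePair.i d })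
      (ℕ.<-irrelevant q<n (FacePair.q<n d)) (ℕ.<-irrelevant pos (FacePair.pos d)))
    (∈-map⁺ _ (∈-allFin (FacePair.i d)))

  facePairs-complete : ∀ d → d List.∈ facePairs
  facePairs-complete d =
    ∈-concatMap⁺ facePairsOver (Any.map (λ { ≡.refl → found (fromℕ< q<n) (toℕ-fromℕ< q<n) }) (∈-allFin (fromℕ< q<n)))
    where
    open FacePair d
    found : ∀ q′ → toℕ q′ ≡ q → d List.∈ facePairsOver q′
    -- The bound and the decision depend on the index, so the transported statement quantifies over
    -- both.
    found q′ eq = ≡.subst (λ q′ → ∀ (q′<n : q′ < n) pos? → d List.∈ facePairsAt q′ q′<n pos?)
      (≡.sym eq) (facePairsAt-complete d) (toℕ<n q′) (0 ℕ.<? K′ (suc (toℕ q′)))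

  -- Incidence as vanishing of the map to the quotient bundle.

  module _ (d : FacePair) where
    private
      module Target {A} (x : Space.Pt Gr[s] A) where
        L : Submodule (Algebra.ring A) _
        L = Summand.L (_⇒_.map (target d) {A} x)
        open Module (Free (Algebra.ring A) (S (FacePair.q d))) public
        open AbelianGroupProps +ᴹ-abelianGroup public using (ε⁻¹≈ε)

        -- Being zero in `Quotient L` unfolds to membership in `L` of the difference with `0ᴹ`,
        -- while incidence speaks of `v` itself.
        minus-zero : ∀ {v} → (v +ᴹ (-ᴹ 0ᴹ)) ≈ᴹ v
        minus-zero = ≈ᴹ-trans (+ᴹ-congˡ ε⁻¹≈ε) (+ᴹ-identityʳ _)

    incidence⇒vanishes : ∀ {A} (x : Space.Pt Gr[s] A) →
      Subspace.holds (incidence d) {A} x → Vanishes K (φ d) {A} x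
    incidence⇒vanishes {A} x inc (v , v∈) = Submodule.resp L (≈ᴹ-sym minus-zero) (inc v∈)
      where open Target {A} x

    vanishes⇒incidence : ∀ {A} (x : Space.Pt Gr[s] A) →
      Vanishes K (φ d) {A} x → Subspace.holds (incidence d) {A} x
    vanishes⇒incidence {A} x h {v} v∈ = Submodule.resp L minus-zero (h (v , v∈))
      where open Target {A} x

  -- The incidence variety as an intersection of loci.

  Gr-simp≗zeroSchemes : Gr-simp ≗ˢ ⋂ (λ d → zeroScheme (φ d))
  Gr-simp≗zeroSchemes {A} x =
    (λ inc d → vanishes⇒zeroScheme K (φ d) {A} x (incidence⇒vanishes d {A} x (inc d))) ,
    (λ h d → vanishes⇒incidence d {A} x (zeroScheme⇒vanishes K (φ d) {A} x (h d)))

  Gr-simp≗degeneracyLoci : Gr-simp ≗ˢ ⋂ (λ d → degeneracyLocus (φ d) 0)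
  Gr-simp≗degeneracyLoci {A} x =
    (λ inc d → zeroScheme⇒degeneracyLocus K (φ d) {A} x (proj₁ (Gr-simp≗zeroSchemes {A} x) inc d)) ,
    (λ h → proj₂ (Gr-simp≗zeroSchemes {A} x) (λ d → degeneracyLocus⇒zeroScheme K (φ d) {A} x (h d)))

  Gr-simp-determinantal : Determinantal Gr-simp
  Gr-simp-determinantal = determinantal K
    (λ d → record { E = 𝒮 d ; F = 𝒬 d ; φ = φ d ; rank = 0 }) facePairs facePairs-complete Gr-simp
    (λ {A} → Gr-simp≗degeneracyLoci {A})

  Gr-simp-loci :
    (Gr-simp ≗ˢ ⋂ (λ d → zeroScheme (φ d))) × (Gr-simp ≗ˢ ⋂ (λ d → degeneracyLocus (φ d) 0)) × Determinantal Gr-simp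
  Gr-simp-loci =
    (λ {A} → Gr-simp≗zeroSchemes {A}) , (λ {A} → Gr-simp≗degeneracyLoci {A}) , Gr-simp-determinantal

proposition8p15 : ∀ {u} (K : HeytingField u u u) → Infinite K →
  ∀ {k} (s : Fin (suc k) → ℕ) → (∀ a → 0 < s a) →
  (R′ : ℕ → ℕ) →
  let Kᴿ = HeytingCommutativeRing.commutativeRing (HeytingField.heytingCommutativeRing K) in
  (∀ p → p ≤ Format.n s → Generic.IsGenericRank Kᴿ s p (R′ p)) →
  let open Geometry Kᴿ
      open Incidence Kᴿ s R′
  in (Gr-simp ≗ˢ ⋂ (λ d → zeroScheme (φ d)))
   × (Gr-simp ≗ˢ ⋂ (λ d → degeneracyLocus (φ d) 0))
   × Determinantal Gr-simp
proposition8p15 K _ s _ R′ _ =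
  Gr-simp-loci (HeytingCommutativeRing.commutativeRing (HeytingField.heytingCommutativeRing K)) s R′
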